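{- Let $q$ be a power of an odd prime and let $(O_t,O_s)$ be a pair of ovals in $PG(2,q)$ such that a Poncelet triangle (a $3$-sided Poncelet polygon) for $(O_t,O_s)$ exists. Then no $m$-sided Poncelet polygon for $(O_t,O_s)$ exists for any $4\le m\le q+1$.
   Context: $PG(2,q)$ is the projective plane over $GF(q)$: points are nonzero vectors $[x,y,z]^T\in GF(q)^3$ up to nonzero scalars, lines are nonzero row vectors $[a,b,c]$ up to nonzero scalars, with incidence $ax+by+cz=0$. An oval in $PG(2,q)$ is a set of $q+1$ points no three of which are collinear. A tangent of an oval $O$ is a line meeting $O$ in exactly one point. For an ordered pair of ovals $(O_t,O_s)$, an $m$-sided Poncelet polygon ($3\le m\le q+1$) is a cyclically ordered $m$-tuple of distinct points of $O_s$ such that each line joining two cyclically consecutive vertices is a tangent of $O_t$. -}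

module Defs where

open import Level using (0ℓ)
open import Data.Nat using (ℕ; suc; _^_; _≤_)
open import Data.Nat.Primality using (Prime)
open import Data.Fin using (Fin; toℕ; fromℕ<)
open import Data.Nat.DivMod using (_%_; m%n<n)
open import Data.Fin.Properties using ()
open import Data.Product using (Σ; ∃; _×_; _,_)
open import Relation.Binary.PropositionalEquality using (_≡_)
open import Relation.Nullary using (¬_)
open import Algebra.Structures using (IsCommutativeRing)
open import Function.Bundles using (_↔_)
open import Function.Definitions using (Injective)

OddPrimePower : ℕ → Set
OddPrimePower q = Σ ℕ λ p → Σ ℕ λ k → Prime p × ¬ (p ≡ 2) × 1 ≤ k × q ≡ p ^ k

record Field : Set₁ where
  infixl 7 _*_
  infixl 6 _+_
  field
    Carrier : Set
    _+_ _*_ : Carrier → Carrier → Carrier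
    -_      : Carrier → Carrier
    0# 1#   : Carrier
    isCommutativeRing : IsCommutativeRing _≡_ _+_ _*_ -_ 0# 1#
    0≢1     : ¬ (0# ≡ 1#)
    inverse : ∀ x → ¬ (x ≡ 0#) → Σ Carrier λ y → x * y ≡ 1#

record FiniteField (q : ℕ) : Set₁ where
  field
    field' : Field
  open Field field' public
  field
    enumeration : Carrier ↔ Fin q

module PG2 {q : ℕ} (F : FiniteField q) where
  open FiniteField F

  -- homogeneous coordinates (column vectors [x,y,z]^T, row vectors [a,b,c])
  record Vec3 : Set where
    constructor ⟨_,_,_⟩
    field
      c₀ c₁ c₂ : Carrier

  open Vec3

  IsZero : Vec3 → Set
  IsZero v = (c₀ v ≡ 0#) × (c₁ v ≡ 0#) × (c₂ v ≡ 0#)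

  -- points and lines of PG(2,q): nonzero vectors (up to nonzero scalars)
  Point : Set
  Point = Σ Vec3 λ v → ¬ IsZero v

  Line : Set
  Line = Σ Vec3 λ v → ¬ IsZero v

  scale : Carrier → Vec3 → Vec3
  scale λ' v = ⟨ λ' * c₀ v , λ' * c₁ v , λ' * c₂ v ⟩

  SamePoint : Point → Point → Set
  SamePoint (u , _) (v , _) = Σ Carrier λ λ' → ¬ (λ' ≡ 0#) × (scale λ' u ≡ v)

  Incident : Point → Line → Set
  Incident (v , _) (l , _) = c₀ l * c₀ v + c₁ l * c₁ v + c₂ l * c₂ v ≡ 0#

  Collinear : Point → Point → Point → Set
  Collinear P Q R = Σ Line λ L → Incident P L × Incident Q L × Incident R L

  record Oval : Set where
    field
      pt       : Fin (suc q) → Point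
      distinct : ∀ i j → SamePoint (pt i) (pt j) → i ≡ j
      noThree  : ∀ i j k → ¬ (i ≡ j) → ¬ (i ≡ k) → ¬ (j ≡ k) →
                 ¬ Collinear (pt i) (pt j) (pt k)

  open Oval public

  Tangent : Oval → Line → Set
  Tangent O L = Σ (Fin (suc q)) λ i → Incident (pt O i) L ×
                  (∀ j → Incident (pt O j) L → j ≡ i)

  next : {m : ℕ} → Fin (suc m) → Fin (suc m)
  next {m} i = fromℕ< (m%n<n (suc (toℕ i)) (suc m))

  cyc : {m : ℕ} → Fin m → Fin m
  cyc {suc m} i = next i

  record PonceletPolygon (Oₜ Oₛ : Oval) (m : ℕ) : Set where
    field
      3≤m      : 3 ≤ m
      m≤q+1    : m ≤ suc q
      vertex   : Fin m → Fin (suc q)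
      injective : Injective _≡_ _≡_ vertex
      sides    : ∀ (i : Fin m) → Σ Line λ L →
                   Incident (pt Oₛ (vertex i)) L ×
                   Incident (pt Oₛ (vertex (cyc i))) L × Tangent Oₜ L

module Submission where

-- By the lemma of tangents (Segre), the points of an oval of odd order satisfy the equation of a conic,
-- and its tangents satisfy the equation of the dual conic.  Take the vertices A, B, C of the given
-- triangle as frame: Oₛ lies on f yz + g zx + h xy = 0, and the coefficients [a,b,c] of a tangent of Oₜ
-- satisfy F bc + G ca + H ab = 0.  It follows that a line joining two points of Oₛ other than A, B, C
-- can be tangent to Oₜ only if the two points are conjugate with respect to the conic
-- (F/f) x² + (G/g) y² + (H/h) z² = 0.  Since the self-polar triangle ABC is inscribed in Oₛ, two points of
-- Oₛ conjugate to a third one are conjugate to each other.  Hence if v₀v₁, v₁v₂ and v₂v₃ are tangents,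
-- then v₀, v₁ and v₃ lie on the polar of v₂, although no three points of Oₛ are collinear.

open import Defs
open import Level using (0ℓ)
open import Algebra.Bundles using (CommutativeMonoid; CommutativeRing)
import Algebra.Properties.CommutativeMonoid.Sum as CommutativeMonoidSum
import Algebra.Properties.Monoid.Mult as Mult
open import Data.Empty using (⊥; ⊥-elim)
open import Data.Fin using (Fin; zero; suc; punchIn; punchOut; _↑ˡ_)
open import Data.Fin.Patterns using (0F; 1F; 2F; 3F)
open import Data.Fin.Permutation using (Permutation′; permutation)
open import Data.Fin.Properties using (any?; ¬∀⟶∃¬; punchInᵢ≢i; punchIn-injective; punchOut-injective; ↑ˡ-injective; <⇒notInjective)
  renaming (_≟_ to _≟ᶠ_)
open import Data.Integer as ℤ using (ℤ; +_; -[1+_])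
import Data.Integer.Properties as ℤₚ
import Data.Maybe as Maybe
open import Data.Nat as ℕ using (ℕ; zero; suc; _≤_; s≤s; _^_)
open import Data.Nat.Divisibility using (divides)
open import Data.Nat.Primality using (Prime; prime⇒irreducible)
import Data.Nat.Properties as ℕₚ
open import Data.Nat.Solver using (module +-*-Solver)
open import Data.Product using (Σ; ∃; _×_; _,_; proj₁; proj₂)
open import Data.Sum using (_⊎_; inj₁; inj₂)
open import Function using (_∘_; Inverse; Injection)
open import Function.Definitions using (Injective)
open import Function.Properties.Inverse using (Inverse⇒Injection)
open import Relation.Binary.Definitions using (DecidableEquality)
open import Relation.Binary.PropositionalEquality hiding (setoid)
open import Relation.Nullary using (¬_; Dec; yes; no; contradiction; ¬?; _×-dec_)
open import Relation.Nullary.Decidable using (dec⇒maybe; via-injection)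

-- Away from the frame both equations are linear in reciprocals: f/x + g/y + h/z = 0 for points and
-- F/a + G/b + H/c = 0 for tangents. If a line [a,b,c] meets the conic in two points, the products
-- of their coordinates satisfy xx′ : yy′ : zz′ = f/a : g/b : h/c. Substituting this into the second
-- equation turns tangency of the joining line into a bilinear condition on the two points, which is
-- the stated conjugacy. The same proportion, applied to the polar of a point instead of a tangent,
-- gives the transitivity of conjugacy on `Oₛ`. Reciprocals fail at A, B and C, so lines through
-- these points need a separate argument: such a tangent is a side of the triangle.
--
-- For the lemma of tangents, the lines of three pencils are parametrised by the whole field and all
-- parameters are multiplied. Only the cube of the product of the nonzero field elements is needed,
-- so its value is found directly, without Wilson's theorem.

-- A polynomial solver with integer coefficients.

module IntegerCoefficients (R : CommutativeRing 0ℓ 0ℓ) where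
  open CommutativeRing R
    using (Carrier; _≈_; _+_; _*_; -_; 0#; 1#; ring; semiring; setoid; +-comm;
           +-cong; +-congˡ; +-congʳ; -‿cong; -‿inverseʳ; +-identityˡ; +-identityʳ;
           +-abelianGroup; +-group)
  open import Algebra.Properties.Ring ring using (-‿distribˡ-*)
  open import Algebra.Properties.AbelianGroup +-abelianGroup using (⁻¹-∙-comm)
  open import Algebra.Properties.Group +-group using (⁻¹-involutive; ε⁻¹≈ε)
  open import Algebra.Properties.Semiring.Mult.TCOptimised semiring
    using (×-homo-+; ×1-homo-*; 1+×) renaming (_×_ to _·_)
  open import Algebra.Solver.Ring.AlmostCommutativeRing
    using (fromCommutativeRing; _-Raw-AlmostCommutative⟶_)
  open import Relation.Binary.Reasoning.Setoid setoid
  open import Algebra.Properties.CommutativeSemigroup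
    (CommutativeRing.+-commutativeSemigroup R) using (interchange)
  private module R = CommutativeRing R

  -- With the optimised multiple, `fromℤ (+ 0)` and `fromℤ (+ 1)` reduce to `0#` and `1#`, so
  -- `con (+ 0)` and `con (+ 1)` stand for these constants in every call of the solver.
  fromℤ : ℤ → Carrier
  fromℤ (+ n)    = n · 1#
  fromℤ -[1+ n ] = - (suc n · 1#)

  fromℤ-neg : ∀ i → fromℤ (ℤ.- i) ≈ - fromℤ i
  fromℤ-neg (+ zero)  = R.sym ε⁻¹≈ε
  fromℤ-neg (+ suc n) = R.refl
  fromℤ-neg -[1+ n ]  = R.sym (⁻¹-involutive _)

  fromℤ-⊖ : ∀ m n → fromℤ (m ℤ.⊖ n) ≈ m · 1# + - (n · 1#)
  fromℤ-⊖ m zero = R.sym (R.trans (+-congˡ ε⁻¹≈ε) (+-identityʳ _))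
  fromℤ-⊖ zero (suc n) = R.sym (+-identityˡ _)
  fromℤ-⊖ (suc m) (suc n) = begin
    fromℤ (suc m ℤ.⊖ suc n)                  ≡⟨ cong fromℤ (ℤₚ.[1+m]⊖[1+n]≡m⊖n m n) ⟩
    fromℤ (m ℤ.⊖ n)                          ≈⟨ fromℤ-⊖ m n ⟩
    m · 1# + - (n · 1#)                      ≈⟨ +-identityˡ _ ⟨
    0# + (m · 1# + - (n · 1#))               ≈⟨ +-congʳ (-‿inverseʳ 1#) ⟨
    (1# + - 1#) + (m · 1# + - (n · 1#))      ≈⟨ interchange 1# (- 1#) (m · 1#) (- (n · 1#)) ⟩
    (1# + m · 1#) + (- 1# + - (n · 1#))      ≈⟨ +-cong (1+× m 1#) (R.sym (⁻¹-∙-comm 1# (n · 1#))) ⟨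
    suc m · 1# + - (1# + n · 1#)             ≈⟨ +-congˡ (-‿cong (1+× n 1#)) ⟨
    suc m · 1# + - (suc n · 1#)              ∎

  fromℤ-+ : ∀ i j → fromℤ (i ℤ.+ j) ≈ fromℤ i + fromℤ j
  fromℤ-+ (+ m)    (+ n)    = ×-homo-+ 1# m n
  fromℤ-+ (+ m)    -[1+ n ] = fromℤ-⊖ m (suc n)
  fromℤ-+ -[1+ m ] (+ n)    = R.trans (fromℤ-⊖ n (suc m)) (+-comm _ _)
  fromℤ-+ -[1+ m ] -[1+ n ] = begin
    - (suc (suc (m ℕ.+ n)) · 1#)     ≡⟨ cong (λ k → - (suc k · 1#)) (ℕₚ.+-suc m n) ⟨
    - ((suc m ℕ.+ suc n) · 1#)       ≈⟨ -‿cong (×-homo-+ 1# (suc m) (suc n)) ⟩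
    - (suc m · 1# + suc n · 1#)      ≈⟨ ⁻¹-∙-comm _ _ ⟨
    - (suc m · 1#) + - (suc n · 1#)  ∎

  fromℤ-+* : ∀ m j → fromℤ (+ m ℤ.* j) ≈ m · 1# * fromℤ j
  fromℤ-+* m (+ n) = begin
    fromℤ (+ m ℤ.* + n)      ≡⟨ cong fromℤ (ℤₚ.pos-* m n) ⟨
    (m ℕ.* n) · 1#           ≈⟨ ×1-homo-* m n ⟩
    m · 1# * (n · 1#)        ∎
  fromℤ-+* m -[1+ n ] = begin
    fromℤ (+ m ℤ.* -[1+ n ])         ≡⟨ cong fromℤ (ℤₚ.neg-distribʳ-* (+ m) (+ suc n)) ⟨
    fromℤ (ℤ.- (+ m ℤ.* + suc n))    ≈⟨ fromℤ-neg (+ m ℤ.* + suc n) ⟩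
    - fromℤ (+ m ℤ.* + suc n)        ≈⟨ -‿cong (fromℤ-+* m (+ suc n)) ⟩
    - (m · 1# * (suc n · 1#))        ≈⟨ -‿distribʳ-* _ _ ⟩
    m · 1# * - (suc n · 1#)          ∎
    where open import Algebra.Properties.Ring ring using (-‿distribʳ-*)

  fromℤ-* : ∀ i j → fromℤ (i ℤ.* j) ≈ fromℤ i * fromℤ j
  fromℤ-* (+ m) j = fromℤ-+* m j
  fromℤ-* -[1+ m ] j = begin
    fromℤ (-[1+ m ] ℤ.* j)         ≡⟨ cong fromℤ (ℤₚ.neg-distribˡ-* (+ suc m) j) ⟨
    fromℤ (ℤ.- (+ suc m ℤ.* j))    ≈⟨ fromℤ-neg (+ suc m ℤ.* j) ⟩
    - fromℤ (+ suc m ℤ.* j)        ≈⟨ -‿cong (fromℤ-+* (suc m) j) ⟩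
    - (suc m · 1# * fromℤ j)       ≈⟨ -‿distribˡ-* _ _ ⟩
    - (suc m · 1#) * fromℤ j       ∎

  morphism : ℤ.+-*-rawRing -Raw-AlmostCommutative⟶ fromCommutativeRing R
  morphism = record
    { ⟦_⟧    = fromℤ
    ; +-homo = fromℤ-+
    ; *-homo = fromℤ-*
    ; -‿homo = fromℤ-neg
    ; 0-homo = R.refl
    ; 1-homo = R.refl
    }

  open import Algebra.Solver.Ring ℤ.+-*-rawRing (fromCommutativeRing R) morphism
    (λ i j → Maybe.map (λ i≡j → R.reflexive (cong fromℤ i≡j)) (dec⇒maybe (i ℤ.≟ j)))
    public using (Polynomial; solve; _:=_; _:+_; _:*_; _:-_; :-_; con)

-- Injections of finite sets, and sums over them.

-- Pigeonhole: removing a missed value from the target would leave an injection into a smaller set.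
injective⇒surjective : ∀ {n} (f : Fin n → Fin n) → Injective _≡_ _≡_ f → ∀ y → ∃ λ x → f x ≡ y
injective⇒surjective {suc n} f inj y with any? (λ x → f x ≟ᶠ y)
... | yes found = found
... | no missed = ⊥-elim (<⇒notInjective {f = λ x → punchOut (y≢f x)} ℕₚ.≤-refl
                            (λ eq → inj (punchOut-injective (y≢f _) (y≢f _) eq)))
  where
  y≢f : ∀ x → y ≢ f x
  y≢f x y≡fx = missed (x , sym y≡fx)

injective⇒permutation : ∀ {n} (f : Fin n → Fin n) → Injective _≡_ _≡_ f → Permutation′ n
injective⇒permutation f inj = permutation f (proj₁ ∘ onto) (proj₂ ∘ onto) (λ x → inj (proj₂ (onto (f x))))
  where
  onto = injective⇒surjective f inj

Odd : ℕ → Set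
Odd n = ∃ λ k → n ≡ suc (k ℕ.+ k)

-- The monoid is abstract because both the additive and the multiplicative monoid of the field are
-- used.
module FiniteSums (M : CommutativeMonoid 0ℓ 0ℓ) where
  open CommutativeMonoid M
  open CommutativeMonoidSum M public
  open Mult monoid using () renaming (_×_ to _·_)

  sum-injective : ∀ {n} (h : Fin n → Carrier) {f : Fin n → Fin n} → Injective _≡_ _≡_ f →
                  sum (h ∘ f) ≈ sum h
  sum-injective h inj = CommutativeMonoid.sym M (sum-permute h (injective⇒permutation _ inj))

  -- Carries the correction at one exceptional index, so that a pointwise identity with a few
  -- exceptions can be summed over all indices.
  pulse : ∀ {n} → Fin n → Carrier → Fin n → Carrier
  pulse i x j with j ≟ᶠ i
  ... | yes _ = x
  ... | no _  = ε

  pulse-at : ∀ {n} (i : Fin n) x → pulse i x i ≡ x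
  pulse-at i x with i ≟ᶠ i
  ... | yes _   = _≡_.refl
  ... | no i≢i = contradiction _≡_.refl i≢i

  pulse-off : ∀ {n} {i j : Fin n} x → j ≢ i → pulse i x j ≡ ε
  pulse-off {i = i} {j} x j≢i with j ≟ᶠ i
  ... | yes j≡i = contradiction j≡i j≢i
  ... | no _    = _≡_.refl

  sum-pulse : ∀ {n} (i : Fin n) x → sum (pulse i x) ≈ x
  sum-pulse {suc n} i x = begin
    sum (pulse i x)                                  ≈⟨ sum-remove {i = i} (pulse i x) ⟩
    pulse i x i ∙ sum (λ j → pulse i x (punchIn i j)) ≡⟨ cong₂ _∙_ (pulse-at i x) (sum-cong-≗ (λ j → pulse-off x (punchInᵢ≢i i j))) ⟩
    x ∙ sum {n} (λ _ → ε)                             ≈⟨ ∙-congˡ (sum-replicate-zero n) ⟩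
    x ∙ ε                                             ≈⟨ identityʳ x ⟩
    x                                                 ∎
    where open import Relation.Binary.Reasoning.Setoid setoid

  odd-×-involution : ∀ k {x} → x ∙ x ≈ ε → suc (k ℕ.+ k) · x ≈ x
  odd-×-involution zero    {x} x²≈ε = identityʳ x
  odd-×-involution (suc k) {x} x²≈ε rewrite ℕₚ.+-suc k k = begin
    x ∙ (x ∙ (suc (k ℕ.+ k) · x))  ≈⟨ assoc x x _ ⟨
    (x ∙ x) ∙ (suc (k ℕ.+ k) · x)  ≈⟨ ∙-cong x²≈ε (odd-×-involution k x²≈ε) ⟩
    ε ∙ x                          ≈⟨ identityˡ x ⟩
    x                              ∎
    where open import Relation.Binary.Reasoning.Setoid setoid

  -- Used additively at 1, to exclude 1 + 1 = 0, and multiplicatively at -1, to evaluate a product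
  -- of `q` factors -1.
  odd-sum : ∀ {n x} → Odd n → x ∙ x ≈ ε → sum {n} (λ _ → x) ≈ x
  odd-sum {n} (k , _≡_.refl) x²≈ε = CommutativeMonoid.trans M (sum-replicate n) (odd-×-involution k x²≈ε)

-- Arithmetic and products in a finite field of odd order.

module FieldTheory {q : ℕ} (F : FiniteField q) where
  open FiniteField F public

  commutativeRing : CommutativeRing 0ℓ 0ℓ
  commutativeRing = record { isCommutativeRing = isCommutativeRing }

  open CommutativeRing commutativeRing public
    using (*-comm; *-assoc; *-identityˡ; *-identityʳ; +-identityˡ; +-identityʳ; zeroˡ; zeroʳ;
           *-commutativeMonoid; +-commutativeMonoid; -‿inverseʳ)
  open IntegerCoefficients commutativeRing public
    using (Polynomial; solve; _:=_; _:+_; _:*_; _:-_; :-_; con)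
  open ≡-Reasoning

  infixl 6 _-_
  _-_ : Carrier → Carrier → Carrier
  x - y = x + - y

  index : Carrier → Fin q
  index = Inverse.to enumeration

  element : Fin q → Carrier
  element = Inverse.from enumeration

  element-index : ∀ x → element (index x) ≡ x
  element-index x = Inverse.strictlyInverseʳ enumeration x

  index-element : ∀ i → index (element i) ≡ i
  index-element i = Inverse.strictlyInverseˡ enumeration i

  index-injective : Injective _≡_ _≡_ index
  index-injective = Injection.injective (Inverse⇒Injection enumeration)

  element-injective : Injective _≡_ _≡_ element
  element-injective {i} {j} eq = trans (sym (index-element i)) (trans (cong index eq) (index-element j))

  infix 4 _≟_
  _≟_ : DecidableEquality Carrier
  _≟_ = via-injection (Inverse⇒Injection enumeration) _≟ᶠ_

  x-y≡0⇒x≡y : ∀ {x y} → x - y ≡ 0# → x ≡ y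
  x-y≡0⇒x≡y {x} {y} eq = begin
    x            ≡⟨ solve 2 (λ x y → x := (x :- y) :+ y) refl x y ⟩
    (x - y) + y  ≡⟨ cong (_+ y) eq ⟩
    0# + y       ≡⟨ +-identityˡ y ⟩
    y            ∎

  x≡y⇒x-y≡0 : ∀ {x y} → x ≡ y → x - y ≡ 0#
  x≡y⇒x-y≡0 {x} refl = -‿inverseʳ x

  1≢0 : 1# ≢ 0#
  1≢0 1≡0 = 0≢1 (sym 1≡0)

  -- inv 0# is 0#, so that inv is a bijection.
  inv : Carrier → Carrier
  inv x with x ≟ 0#
  ... | yes _   = 0#
  ... | no x≢0 = proj₁ (inverse x x≢0)

  inv-0 : inv 0# ≡ 0#
  inv-0 with 0# ≟ 0#
  ... | yes _   = refl
  ... | no 0≢0 = contradiction refl 0≢0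

  x*inv-x : ∀ {x} → x ≢ 0# → x * inv x ≡ 1#
  x*inv-x {x} x≢0 with x ≟ 0#
  ... | yes x≡0 = contradiction x≡0 x≢0
  ... | no x≢0′ = proj₂ (inverse x x≢0′)

  xy≡0⇒y≡0 : ∀ {x y} → x ≢ 0# → x * y ≡ 0# → y ≡ 0#
  xy≡0⇒y≡0 {x} {y} x≢0 xy≡0 = begin
    y                ≡⟨ *-identityˡ y ⟨
    1# * y           ≡⟨ cong (_* y) (x*inv-x x≢0) ⟨
    x * inv x * y    ≡⟨ solve 3 (λ x i y → x :* i :* y := i :* (x :* y)) refl x (inv x) y ⟩
    inv x * (x * y)  ≡⟨ cong (inv x *_) xy≡0 ⟩
    inv x * 0#       ≡⟨ zeroʳ (inv x) ⟩
    0#               ∎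

  *-≢0 : ∀ {x y} → x ≢ 0# → y ≢ 0# → x * y ≢ 0#
  *-≢0 x≢0 y≢0 xy≡0 = y≢0 (xy≡0⇒y≡0 x≢0 xy≡0)

  *-cancelˡ : ∀ {x y z} → x ≢ 0# → x * y ≡ x * z → y ≡ z
  *-cancelˡ {x} {y} {z} x≢0 eq = x-y≡0⇒x≡y (xy≡0⇒y≡0 x≢0 (begin
    x * (y - z)    ≡⟨ solve 3 (λ x y z → x :* (y :- z) := x :* y :- x :* z) refl x y z ⟩
    x * y - x * z  ≡⟨ x≡y⇒x-y≡0 eq ⟩
    0#             ∎))

  neg-≢0 : ∀ {x} → x ≢ 0# → - x ≢ 0#
  neg-≢0 {x} x≢0 -x≡0 = x≢0 (begin
    x          ≡⟨ solve 1 (λ x → x := con (+ 0) :- (:- x)) refl x ⟩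
    0# - - x   ≡⟨ x≡y⇒x-y≡0 (sym -x≡0) ⟩
    0#         ∎)

  inv-≢0 : ∀ {x} → x ≢ 0# → inv x ≢ 0#
  inv-≢0 {x} x≢0 i≡0 = 1≢0 (begin
    1#         ≡⟨ x*inv-x x≢0 ⟨
    x * inv x  ≡⟨ cong (x *_) i≡0 ⟩
    x * 0#     ≡⟨ zeroʳ x ⟩
    0#         ∎)

  inv-unique : ∀ {x y} → x * y ≡ 1# → inv x ≡ y
  inv-unique {x} {y} xy≡1 = *-cancelˡ x≢0 (trans (x*inv-x x≢0) (sym xy≡1))
    where
    x≢0 : x ≢ 0#
    x≢0 refl = 1≢0 (trans (sym xy≡1) (zeroˡ y))

  inv-involutive : ∀ x → inv (inv x) ≡ x
  inv-involutive x with x ≟ 0#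
  ... | yes refl = inv-0
  ... | no x≢0   = inv-unique (trans (*-comm _ x) (proj₂ (inverse x x≢0)))

  inv-injective : Injective _≡_ _≡_ inv
  inv-injective {x} {y} eq = trans (sym (inv-involutive x)) (trans (cong inv eq) (inv-involutive y))

  x*inv-y≡z⇒x≡z*y : ∀ {x y z} → y ≢ 0# → x * inv y ≡ z → x ≡ z * y
  x*inv-y≡z⇒x≡z*y {x} {y} {z} y≢0 eq = begin
    x                ≡⟨ *-identityʳ x ⟨
    x * 1#           ≡⟨ cong (x *_) (x*inv-x y≢0) ⟨
    x * (y * inv y)  ≡⟨ solve 3 (λ x y i → x :* (y :* i) := x :* i :* y) refl x y (inv y) ⟩
    x * inv y * y    ≡⟨ cong (_* y) eq ⟩
    z * y            ∎

  -- Removes the factor zero from a product over the whole field.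
  unit : Carrier → Carrier
  unit x with x ≟ 0#
  ... | yes _ = 1#
  ... | no _  = x

  unit-0 : ∀ {x} → x ≡ 0# → unit x ≡ 1#
  unit-0 {x} x≡0 with x ≟ 0#
  ... | yes _  = refl
  ... | no x≢0 = contradiction x≡0 x≢0

  unit-≢0 : ∀ {x} → x ≢ 0# → unit x ≡ x
  unit-≢0 {x} x≢0 with x ≟ 0#
  ... | yes x≡0 = contradiction x≡0 x≢0
  ... | no _    = refl

  module Sums = FiniteSums +-commutativeMonoid
  module Products = FiniteSums *-commutativeMonoid
  open Products public using (pulse) renaming (sum to ∏)

  sum-bijection : (h : Carrier → Carrier) {f : Fin q → Carrier} → Injective _≡_ _≡_ f →
                  Sums.sum (h ∘ f) ≡ Sums.sum (h ∘ element)
  sum-bijection h {f} inj = trans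
    (Sums.sum-cong-≗ (λ i → cong h (sym (element-index (f i)))))
    (Sums.sum-injective (h ∘ element) (λ eq → inj (index-injective eq)))

  ∏-bijection : (h : Carrier → Carrier) {f : Fin q → Carrier} → Injective _≡_ _≡_ f →
                ∏ (h ∘ f) ≡ ∏ (h ∘ element)
  ∏-bijection h {f} inj = trans
    (Products.sum-cong-≗ (λ i → cong h (sym (element-index (f i)))))
    (Products.sum-injective (h ∘ element) (λ eq → inj (index-injective eq)))

  ∏units : Carrier
  ∏units = ∏ (unit ∘ element)

  module _ (odd : Odd q) where

    -- Translation by 1 permutes the field, so q times 1 vanishes.
    1+1≢0 : 1# + 1# ≢ 0#
    1+1≢0 1+1≡0 = 1≢0 (begin
      1#                                     ≡⟨ Sums.odd-sum odd 1+1≡0 ⟨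
      Sums.sum {q} (λ _ → 1#)                   ≡⟨ cancel _ _ (trans (sym (Sums.∑-distrib-+ element (λ _ → 1#))) (sum-bijection (λ x → x) shift-injective)) ⟩
      0#                                     ∎)
      where
      cancel : ∀ s t → s + t ≡ s → t ≡ 0#
      cancel s t eq = trans (solve 2 (λ s t → t := (s :+ t) :- s) refl s t) (x≡y⇒x-y≡0 eq)
      shift-injective : Injective _≡_ _≡_ (λ i → element i + 1#)
      shift-injective eq = element-injective (x-y≡0⇒x≡y (trans
        (solve 3 (λ x y z → x :- y := (x :+ z) :- (y :+ z)) refl _ _ 1#) (x≡y⇒x-y≡0 eq)))

    -- The three maps s, 1/(1-s), 1-1/s are bijections of the field once 1/0 = 0, and their product is
    -- -1 away from s = 0 and s = 1.
    ∏units³ : ∏units * (∏units * ∏units) ≡ - 1#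
    ∏units³ = begin
      ∏units * (∏units * ∏units)
        ≡⟨ cong₂ (λ u v → ∏units * (u * v)) (∏-bijection unit μ₁-injective) (∏-bijection unit μ₂-injective) ⟨
      ∏ (unit ∘ element) * (∏ (unit ∘ μ₁) * ∏ (unit ∘ μ₂))
        ≡⟨ cong (∏ (unit ∘ element) *_) (Products.∑-distrib-+ (unit ∘ μ₁) (unit ∘ μ₂)) ⟨
      ∏ (unit ∘ element) * ∏ (λ i → unit (μ₁ i) * unit (μ₂ i))
        ≡⟨ Products.∑-distrib-+ (unit ∘ element) _ ⟨
      ∏ (λ i → unit (element i) * (unit (μ₁ i) * unit (μ₂ i)))
        ≡⟨ Products.sum-cong-≗ pointwise ⟩
      ∏ (λ i → - 1# * (pulse (index 0#) (- 1#) i * pulse (index 1#) (- 1#) i))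
        ≡⟨ Products.∑-distrib-+ (λ _ → - 1#) (λ i → pulse (index 0#) (- 1#) i * pulse (index 1#) (- 1#) i) ⟩
      ∏ {q} (λ _ → - 1#) * ∏ (λ i → pulse (index 0#) (- 1#) i * pulse (index 1#) (- 1#) i)
        ≡⟨ cong₂ _*_ (Products.odd-sum odd -1*-1≡1) (Products.∑-distrib-+ (pulse (index 0#) (- 1#)) (pulse (index 1#) (- 1#))) ⟩
      - 1# * (∏ (pulse (index 0#) (- 1#)) * ∏ (pulse (index 1#) (- 1#)))
        ≡⟨ cong₂ (λ u v → - 1# * (u * v)) (Products.sum-pulse (index 0#) (- 1#)) (Products.sum-pulse (index 1#) (- 1#)) ⟩
      - 1# * (- 1# * - 1#)
        ≡⟨ cong (- 1# *_) -1*-1≡1 ⟩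
      - 1# * 1#
        ≡⟨ *-identityʳ _ ⟩
      - 1# ∎
      where
      -1*-1≡1 : - 1# * - 1# ≡ 1#
      -1*-1≡1 = solve 0 (:- con (+ 1) :* :- con (+ 1) := con (+ 1)) refl

      μ₁ μ₂ : Fin q → Carrier
      μ₁ i = inv (1# - element i)
      μ₂ i = 1# - inv (element i)

      1-x-injective : ∀ {x y} → 1# - x ≡ 1# - y → x ≡ y
      1-x-injective {x} {y} eq = x-y≡0⇒x≡y (trans
        (solve 3 (λ x y z → x :- y := (z :- y) :- (z :- x)) refl x y 1#) (x≡y⇒x-y≡0 (sym eq)))

      μ₁-injective : Injective _≡_ _≡_ μ₁
      μ₁-injective eq = element-injective (1-x-injective (inv-injective eq))

      μ₂-injective : Injective _≡_ _≡_ μ₂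
      μ₂-injective eq = element-injective (inv-injective (1-x-injective eq))

      1-0≡1 : 1# - 0# ≡ 1#
      1-0≡1 = solve 0 (con (+ 1) :- con (+ 0) := con (+ 1)) refl

      inv-1 : inv 1# ≡ 1#
      inv-1 = inv-unique (*-identityˡ 1#)

      -- At 0 and 1 the conventions for `inv` and `unit` make all three factors 1, so the product is
      -- 1 instead of -1; each pulse repairs one of these signs. The element is a variable here, so
      -- that both special cases can be matched with `refl`.
      pointwise′ : ∀ x → Dec (x ≡ 0#) → Dec (x ≡ 1#) → unit x * (unit (inv (1# - x)) * unit (1# - inv x)) ≡
                         - 1# * (pulse (index 0#) (- 1#) (index x) * pulse (index 1#) (- 1#) (index x))
      pointwise′ x (yes refl) _ = begin
        unit 0# * (unit (inv (1# - 0#)) * unit (1# - inv 0#))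
          ≡⟨ cong (_* (unit (inv (1# - 0#)) * unit (1# - inv 0#))) (unit-0 refl) ⟩
        1# * (unit (inv (1# - 0#)) * unit (1# - inv 0#))
          ≡⟨ cong₂ (λ u v → 1# * (unit u * unit v)) (trans (cong inv 1-0≡1) inv-1) (trans (cong (λ u → 1# - u) inv-0) 1-0≡1) ⟩
        1# * (unit 1# * unit 1#)
          ≡⟨ cong (λ u → 1# * (u * u)) (unit-≢0 1≢0) ⟩
        1# * (1# * 1#)
          ≡⟨ solve 0 (con (+ 1) :* (con (+ 1) :* con (+ 1)) := :- con (+ 1) :* (:- con (+ 1) :* con (+ 1))) refl ⟩
        - 1# * (- 1# * 1#)
          ≡⟨ cong₂ (λ u v → - 1# * (u * v)) (Products.pulse-at (index 0#) (- 1#)) (Products.pulse-off (- 1#) (λ eq → 0≢1 (index-injective eq))) ⟨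
        - 1# * (pulse (index 0#) (- 1#) (index 0#) * pulse (index 1#) (- 1#) (index 0#)) ∎
      pointwise′ x (no 1≢0) (yes refl) = begin
        unit 1# * (unit (inv (1# - 1#)) * unit (1# - inv 1#))
          ≡⟨ cong (_* (unit (inv (1# - 1#)) * unit (1# - inv 1#))) (unit-≢0 1≢0) ⟩
        1# * (unit (inv (1# - 1#)) * unit (1# - inv 1#))
          ≡⟨ cong₂ (λ u v → 1# * (u * v)) (unit-0 (trans (cong inv (-‿inverseʳ 1#)) inv-0)) (unit-0 (x≡y⇒x-y≡0 (sym inv-1))) ⟩
        1# * (1# * 1#)
          ≡⟨ solve 0 (con (+ 1) :* (con (+ 1) :* con (+ 1)) := :- con (+ 1) :* (con (+ 1) :* :- con (+ 1))) refl ⟩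
        - 1# * (1# * - 1#)
          ≡⟨ cong₂ (λ u v → - 1# * (u * v)) (Products.pulse-off (- 1#) (λ eq → 1≢0 (index-injective eq))) (Products.pulse-at (index 1#) (- 1#)) ⟨
        - 1# * (pulse (index 0#) (- 1#) (index 1#) * pulse (index 1#) (- 1#) (index 1#)) ∎
      pointwise′ x (no x≢0) (no x≢1) = begin
        unit x * (unit (inv (1# - x)) * unit (1# - inv x))
          ≡⟨ cong (_* (unit (inv (1# - x)) * unit (1# - inv x))) (unit-≢0 x≢0) ⟩
        x * (unit (inv (1# - x)) * unit (1# - inv x))
          ≡⟨ cong₂ (λ u v → x * (u * v)) (unit-≢0 (inv-≢0 1-x≢0)) (unit-≢0 1-x⁻¹≢0) ⟩
        x * (inv (1# - x) * (1# - inv x))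
          ≡⟨ solve 4 (λ x i j o → x :* (j :* (o :- i)) := :- (j :* (x :* i :- x :* o))) refl x (inv x) (inv (1# - x)) 1# ⟩
        - (inv (1# - x) * (x * inv x - x * 1#))
          ≡⟨ cong₂ (λ u v → - (inv (1# - x) * (u - v))) (x*inv-x x≢0) (*-identityʳ x) ⟩
        - (inv (1# - x) * (1# - x))
          ≡⟨ cong -_ (trans (*-comm _ _) (x*inv-x 1-x≢0)) ⟩
        - 1#
          ≡⟨ solve 0 (:- con (+ 1) := :- con (+ 1) :* (con (+ 1) :* con (+ 1))) refl ⟩
        - 1# * (1# * 1#)
          ≡⟨ cong₂ (λ u v → - 1# * (u * v)) (Products.pulse-off (- 1#) (λ eq → x≢0 (index-injective eq))) (Products.pulse-off (- 1#) (λ eq → x≢1 (index-injective eq))) ⟨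
        - 1# * (pulse (index 0#) (- 1#) (index x) * pulse (index 1#) (- 1#) (index x)) ∎
        where
        1-x≢0 : 1# - x ≢ 0#
        1-x≢0 eq = x≢1 (sym (x-y≡0⇒x≡y eq))
        1-x⁻¹≢0 : 1# - inv x ≢ 0#
        1-x⁻¹≢0 eq = x≢1 (inv-injective (trans (sym (x-y≡0⇒x≡y eq)) (sym inv-1)))

      pointwise : ∀ i → unit (element i) * (unit (μ₁ i) * unit (μ₂ i)) ≡
                        - 1# * (pulse (index 0#) (- 1#) i * pulse (index 1#) (- 1#) i)
      pointwise i = trans (pointwise′ (element i) (element i ≟ 0#) (element i ≟ 1#))
        (cong (λ j → - 1# * (pulse (index 0#) (- 1#) j * pulse (index 1#) (- 1#) j)) (index-element i))

-- Determinant identities in homogeneous coordinates.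

module Vectors {q : ℕ} (F : FiniteField q) where
  open FieldTheory F public
  open PG2 F public
  open Vec3 public

  dot : Vec3 → Vec3 → Carrier
  dot l v = c₀ l * c₀ v + c₁ l * c₁ v + c₂ l * c₂ v

  cross : Vec3 → Vec3 → Vec3
  cross ⟨ a₀ , a₁ , a₂ ⟩ ⟨ b₀ , b₁ , b₂ ⟩ =
    ⟨ a₁ * b₂ - a₂ * b₁ , a₂ * b₀ - a₀ * b₂ , a₀ * b₁ - a₁ * b₀ ⟩

  -- In this form `det a b` is also the linear form of the line joining `a` and `b`.
  det : Vec3 → Vec3 → Vec3 → Carrier
  det a b c = dot (cross a b) c

  private
    Triple : ℕ → Set
    Triple n = Polynomial n × Polynomial n × Polynomial n

    dotᴾ : ∀ {n} → Triple n → Triple n → Polynomial n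
    dotᴾ (a₀ , a₁ , a₂) (b₀ , b₁ , b₂) = a₀ :* b₀ :+ a₁ :* b₁ :+ a₂ :* b₂

    crossᴾ : ∀ {n} → Triple n → Triple n → Triple n
    crossᴾ (a₀ , a₁ , a₂) (b₀ , b₁ , b₂) = a₁ :* b₂ :- a₂ :* b₁ , a₂ :* b₀ :- a₀ :* b₂ , a₀ :* b₁ :- a₁ :* b₀

    detᴾ : ∀ {n} → Triple n → Triple n → Triple n → Polynomial n
    detᴾ a b c = dotᴾ (crossᴾ a b) c

  det-cyclic : ∀ a b c → det a b c ≡ det b c a
  det-cyclic a b c = solve 9
    (λ a₀ a₁ a₂ b₀ b₁ b₂ d₀ d₁ d₂ → let a = a₀ , a₁ , a₂; b = b₀ , b₁ , b₂; c = d₀ , d₁ , d₂ in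
      detᴾ a b c := detᴾ b c a)
    refl (c₀ a) (c₁ a) (c₂ a) (c₀ b) (c₁ b) (c₂ b) (c₀ c) (c₁ c) (c₂ c)

  det-aba : ∀ a b → det a b a ≡ 0#
  det-aba a b = solve 6
    (λ a₀ a₁ a₂ b₀ b₁ b₂ → let a = a₀ , a₁ , a₂; b = b₀ , b₁ , b₂ in detᴾ a b a := con (+ 0))
    refl (c₀ a) (c₁ a) (c₂ a) (c₀ b) (c₁ b) (c₂ b)

  det-abb : ∀ a b → det a b b ≡ 0#
  det-abb a b = trans (det-cyclic a b b) (trans (det-cyclic b b a) (det-aba b a))

  -- Up to the factor `det a b c`, the forms `det b c`, `det c a`, `det a b` are the basis dual to
  -- `a`, `b`, `c`; so a line has its values at the three points as coordinates.
  cramer : ∀ a b c l x →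
           det a b c * dot l x ≡ dot l a * det b c x + dot l b * det c a x + dot l c * det a b x
  cramer a b c l x = solve 15
    (λ a₀ a₁ a₂ b₀ b₁ b₂ d₀ d₁ d₂ l₀ l₁ l₂ x₀ x₁ x₂ →
      let a = a₀ , a₁ , a₂; b = b₀ , b₁ , b₂; c = d₀ , d₁ , d₂; l = l₀ , l₁ , l₂; x = x₀ , x₁ , x₂ in
      detᴾ a b c :* dotᴾ l x :=
        dotᴾ l a :* detᴾ b c x :+ dotᴾ l b :* detᴾ c a x :+ dotᴾ l c :* detᴾ a b x)
    refl (c₀ a) (c₁ a) (c₂ a) (c₀ b) (c₁ b) (c₂ b) (c₀ c) (c₁ c) (c₂ c)
         (c₀ l) (c₁ l) (c₂ l) (c₀ x) (c₁ x) (c₂ x)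

  -- The three-term Grassmann-Plücker relation. It says that `det c a x : det a b x` separates the
  -- lines through `a`: the right-hand side is a 2 by 2 determinant, and it vanishes only if `a`,
  -- `x`, `y` are collinear, once `a`, `b`, `c` are not.
  plücker : ∀ a b c x y →
            det a b c * det a x y ≡ det c a x * det a b y - det a b x * det c a y
  plücker a b c x y = solve 15
    (λ a₀ a₁ a₂ b₀ b₁ b₂ d₀ d₁ d₂ x₀ x₁ x₂ y₀ y₁ y₂ →
      let a = a₀ , a₁ , a₂; b = b₀ , b₁ , b₂; c = d₀ , d₁ , d₂; x = x₀ , x₁ , x₂; y = y₀ , y₁ , y₂ in
      detᴾ a b c :* detᴾ a x y := detᴾ c a x :* detᴾ a b y :- detᴾ a b x :* detᴾ c a y)
    refl (c₀ a) (c₁ a) (c₂ a) (c₀ b) (c₁ b) (c₂ b) (c₀ c) (c₁ c) (c₂ c)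
         (c₀ x) (c₁ x) (c₂ x) (c₀ y) (c₁ y) (c₂ y)

  linear-combination : Carrier → Vec3 → Carrier → Vec3 → Vec3
  linear-combination s u t v = ⟨ s * c₀ u + t * c₀ v , s * c₁ u + t * c₁ v , s * c₂ u + t * c₂ v ⟩

  dot-linear-combination : ∀ s u t v x → dot (linear-combination s u t v) x ≡ s * dot u x + t * dot v x
  dot-linear-combination s u t v x = solve 11
    (λ s u₀ u₁ u₂ t v₀ v₁ v₂ x₀ x₁ x₂ →
      dotᴾ (s :* u₀ :+ t :* v₀ , s :* u₁ :+ t :* v₁ , s :* u₂ :+ t :* v₂) (x₀ , x₁ , x₂) :=
      s :* dotᴾ (u₀ , u₁ , u₂) (x₀ , x₁ , x₂) :+ t :* dotᴾ (v₀ , v₁ , v₂) (x₀ , x₁ , x₂))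
    refl s (c₀ u) (c₁ u) (c₂ u) t (c₀ v) (c₁ v) (c₂ v) (c₀ x) (c₁ x) (c₂ x)

-- Tangents of an arc of `q + 1` points and the lemma of tangents.

module Arcs {q : ℕ} (F : FiniteField q) (odd : Odd q) where
  open Vectors F
  open ≡-Reasoning

  module Arc (P : Fin (suc q) → Vec3)
             (arc : ∀ {i j k} → i ≢ j → i ≢ k → j ≢ k → det (P i) (P j) (P k) ≢ 0#) where

    record TangentAt (i : Fin (suc q)) (t : Vec3) : Set where
      field
        meets  : dot t (P i) ≡ 0#
        misses : ∀ {j} → j ≢ i → dot t (P j) ≢ 0#
    open TangentAt

    module Ratio (i j k : Fin (suc q)) where

      -- Parameter of a line through `P i`: the line to `P k` has parameter 0 and the line to `P j`
      -- is the one at infinity, where the convention for `inv` also returns 0.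
      ratio : Fin (suc q) → Carrier
      ratio p = det (P k) (P i) (P p) * inv (det (P i) (P j) (P p))

      ratio-j : ratio j ≡ 0#
      ratio-j = begin
        det (P k) (P i) (P j) * inv (det (P i) (P j) (P j))  ≡⟨ cong (λ z → det (P k) (P i) (P j) * inv z) (det-abb (P i) (P j)) ⟩
        det (P k) (P i) (P j) * inv 0#                       ≡⟨ cong (det (P k) (P i) (P j) *_) inv-0 ⟩
        det (P k) (P i) (P j) * 0#                           ≡⟨ zeroʳ _ ⟩
        0#                                                   ∎

      ratio-k : ratio k ≡ 0#
      ratio-k = trans (cong (_* inv (det (P i) (P j) (P k))) (det-aba (P k) (P i))) (zeroˡ _)

      module _ (i≢j : i ≢ j) (i≢k : i ≢ k) (j≢k : j ≢ k) where

        ratio-injective : ∀ {p p′} → p ≢ i → p ≢ j → p′ ≢ i → p′ ≢ j → ratio p ≡ ratio p′ → p ≡ p′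
        ratio-injective {p} {p′} p≢i p≢j p′≢i p′≢j eq with p ≟ᶠ p′
        ... | yes p≡p′ = p≡p′
        ... | no p≢p′ = contradiction
          (begin
            det (P i) (P j) (P k) * det (P i) (P p) (P p′)
              ≡⟨ plücker (P i) (P j) (P k) (P p) (P p′) ⟩
            Y p * Z p′ - Z p * Y p′
              ≡⟨ cong₂ (λ u v → u * Z p′ - Z p * v) (x*inv-y≡z⇒x≡z*y (Z≢0 p≢i p≢j) eq) (x*inv-y≡z⇒x≡z*y (Z≢0 p′≢i p′≢j) refl) ⟩
            ratio p′ * Z p * Z p′ - Z p * (ratio p′ * Z p′)
              ≡⟨ solve 3 (λ r z z′ → r :* z :* z′ :- z :* (r :* z′) := con (+ 0)) refl (ratio p′) (Z p) (Z p′) ⟩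
            0# ∎)
          (*-≢0 (arc i≢j i≢k j≢k) (arc (≢-sym p≢i) (≢-sym p′≢i) p≢p′))
          where
          Y Z : Fin (suc q) → Carrier
          Y x = det (P k) (P i) (P x)
          Z x = det (P i) (P j) (P x)
          Z≢0 : ∀ {x} → x ≢ i → x ≢ j → Z x ≢ 0#
          Z≢0 x≢i x≢j = arc i≢j (≢-sym x≢i) (≢-sym x≢j)

        -- The line of the pencil with parameter `r` has the linear form Y - rZ, where Y and Z are
        -- the numerator and denominator of the ratio. `P j` is treated apart because its line has
        -- no finite parameter.
        tangent-of-ratio : ∀ r → (∀ p → p ≢ i → p ≢ j → ratio p ≢ r) → ∃ (TangentAt i)
        tangent-of-ratio r avoids = t , record { meets = t-meets ; misses = t-misses }
          where
          t = linear-combination 1# (cross (P k) (P i)) (- r) (cross (P i) (P j))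
          t-value : ∀ x → dot t x ≡ det (P k) (P i) x - r * det (P i) (P j) x
          t-value x = trans (dot-linear-combination 1# (cross (P k) (P i)) (- r) (cross (P i) (P j)) x)
            (solve 3 (λ y r z → con (+ 1) :* y :+ (:- r) :* z := y :- r :* z) refl
              (det (P k) (P i) x) r (det (P i) (P j) x))
          t-meets : dot t (P i) ≡ 0#
          t-meets = trans (t-value (P i)) (trans
            (cong₂ (λ u v → u - r * v) (det-abb (P k) (P i)) (det-aba (P i) (P j)))
            (solve 1 (λ r → con (+ 0) :- r :* con (+ 0) := con (+ 0)) refl r))
          t-misses-j : dot t (P j) ≢ 0#
          t-misses-j tj≡0 = arc (≢-sym i≢k) (≢-sym j≢k) i≢j (begin
            det (P k) (P i) (P j)
              ≡⟨ solve 2 (λ y r → y := y :- r :* con (+ 0)) refl (det (P k) (P i) (P j)) r ⟩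
            det (P k) (P i) (P j) - r * 0#
              ≡⟨ cong (λ z → det (P k) (P i) (P j) - r * z) (det-abb (P i) (P j)) ⟨
            det (P k) (P i) (P j) - r * det (P i) (P j) (P j)
              ≡⟨ t-value (P j) ⟨
            dot t (P j)
              ≡⟨ tj≡0 ⟩
            0# ∎)
          t-misses : ∀ {x} → x ≢ i → dot t (P x) ≢ 0#
          t-misses {x} x≢i tx≡0 with x ≟ᶠ j
          ... | yes refl = t-misses-j tx≡0
          ... | no x≢j = avoids x x≢i x≢j (begin
            det (P k) (P i) (P x) * inv Z  ≡⟨ cong (_* inv Z) (x-y≡0⇒x≡y (trans (sym (t-value (P x))) tx≡0)) ⟩
            r * Z * inv Z                  ≡⟨ *-assoc r Z (inv Z) ⟩
            r * (Z * inv Z)                ≡⟨ cong (r *_) (x*inv-x (arc i≢j (≢-sym x≢i) (≢-sym x≢j))) ⟩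
            r * 1#                         ≡⟨ *-identityʳ r ⟩
            r                              ∎)
            where Z = det (P i) (P j) (P x)

        Ratio-of : Carrier → Fin (suc q) → Set
        Ratio-of r p = p ≢ i × p ≢ j × ratio p ≡ r

        ratio-of? : ∀ r p → Dec (Ratio-of r p)
        ratio-of? r p = ¬? (p ≟ᶠ i) ×-dec (¬? (p ≟ᶠ j) ×-dec (ratio p ≟ r))

        -- Points with different ratios are different. With `i` removed from the index set, `q` such
        -- points would fill it, so one of them would be `P j`.
        not-all-ratios : ¬ (∀ n → ∃ (Ratio-of (element n)))
        not-all-ratios hit = avoids-j (proj₁ j-hit) (punchOut-injective (i≢s _) i≢j (proj₂ j-hit))
          where
          s : Fin q → Fin (suc q)
          s n = proj₁ (hit n)
          i≢s : ∀ n → i ≢ s n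
          i≢s n = ≢-sym (proj₁ (proj₂ (hit n)))
          avoids-j : ∀ n → s n ≢ j
          avoids-j n = proj₁ (proj₂ (proj₂ (hit n)))
          ratio-s : ∀ n → ratio (s n) ≡ element n
          ratio-s n = proj₂ (proj₂ (proj₂ (hit n)))
          s-injective : Injective _≡_ _≡_ s
          s-injective {m} {n} eq = element-injective (trans (sym (ratio-s m)) (trans (cong ratio eq) (ratio-s n)))
          j-hit : ∃ λ n → punchOut (i≢s n) ≡ punchOut i≢j
          j-hit = injective⇒surjective (λ n → punchOut (i≢s n))
                    (λ eq → s-injective (punchOut-injective (i≢s _) (i≢s _) eq)) (punchOut i≢j)

        -- The q - 1 points other than P i and P j do not suffice for q ratios.
        tangent-exists : ∃ (TangentAt i)
        tangent-exists =
          let n , missed = ¬∀⟶∃¬ q (λ n → ∃ (Ratio-of (element n))) (λ n → any? (ratio-of? (element n))) not-all-ratios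
          in tangent-of-ratio (element n) (λ p p≢i p≢j eq → missed (p , p≢i , p≢j , eq))

        module _ {t : Vec3} (T : TangentAt i t) where

          -- The parameter of the tangent: since `t` vanishes at `P i`, `cramer` makes it
          -- proportional to `dot t (P j) * Y + dot t (P k) * Z`, and this is Y/Z on its zeros.
          slope : Carrier
          slope = - (dot t (P k) * inv (dot t (P j)))

          slope*tⱼ : slope * dot t (P j) ≡ - dot t (P k)
          slope*tⱼ = begin
            - (dot t (P k) * inv (dot t (P j))) * dot t (P j)
              ≡⟨ solve 3 (λ c i b → :- (c :* i) :* b := :- (c :* (b :* i))) refl (dot t (P k)) (inv (dot t (P j))) (dot t (P j)) ⟩
            - (dot t (P k) * (dot t (P j) * inv (dot t (P j))))
              ≡⟨ cong (λ z → - (dot t (P k) * z)) (x*inv-x (misses T (≢-sym i≢j))) ⟩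
            - (dot t (P k) * 1#)
              ≡⟨ cong -_ (*-identityʳ _) ⟩
            - dot t (P k) ∎

          slope≢0 : slope ≢ 0#
          slope≢0 = neg-≢0 (*-≢0 (misses T (≢-sym i≢k)) (inv-≢0 (misses T (≢-sym i≢j))))

          -- Equality would put `P p` on the tangent.
          ratio≢slope : ∀ {p} → p ≢ i → p ≢ j → ratio p ≢ slope
          ratio≢slope {p} p≢i p≢j eq = *-≢0 (arc i≢j i≢k j≢k) (misses T p≢i) (begin
            det (P i) (P j) (P k) * dot t (P p)
              ≡⟨ cramer (P i) (P j) (P k) t (P p) ⟩
            dot t (P i) * X + dot t (P j) * Y + dot t (P k) * Z
              ≡⟨ cong₂ (λ u v → u * X + dot t (P j) * v + dot t (P k) * Z) (meets T)
                   (x*inv-y≡z⇒x≡z*y (arc i≢j (≢-sym p≢i) (≢-sym p≢j)) eq) ⟩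
            0# * X + dot t (P j) * (slope * Z) + dot t (P k) * Z
              ≡⟨ solve 5 (λ x b s z c → con (+ 0) :* x :+ b :* (s :* z) :+ c :* z := (s :* b :+ c) :* z) refl
                   X (dot t (P j)) slope Z (dot t (P k)) ⟩
            (slope * dot t (P j) + dot t (P k)) * Z
              ≡⟨ cong (λ z → (z + dot t (P k)) * Z) slope*tⱼ ⟩
            (- dot t (P k) + dot t (P k)) * Z
              ≡⟨ solve 2 (λ c z → (:- c :+ c) :* z := con (+ 0)) refl (dot t (P k)) Z ⟩
            0# ∎)
            where
            X = det (P j) (P k) (P p)
            Y = det (P k) (P i) (P p)
            Z = det (P i) (P j) (P p)

          -- The parameter, in the pencil of lines through P i, of the line joining P i to P p; the
          -- tangent takes the place of the missing line when p = i, and the line joining P i to P j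
          -- is the one at infinity.
          parameter : Fin (suc q) → Carrier
          parameter p with p ≟ᶠ i
          ... | yes _ = slope
          ... | no _  = ratio p

          parameter-i : parameter i ≡ slope
          parameter-i with i ≟ᶠ i
          ... | yes _  = refl
          ... | no i≢i = contradiction refl i≢i

          parameter-off : ∀ {p} → p ≢ i → parameter p ≡ ratio p
          parameter-off {p} p≢i with p ≟ᶠ i
          ... | yes p≡i = contradiction p≡i p≢i
          ... | no _    = refl

          parameter-injective : ∀ {p p′} → p ≢ j → p′ ≢ j → parameter p ≡ parameter p′ → p ≡ p′
          parameter-injective {p} {p′} p≢j p′≢j eq with p ≟ᶠ i | p′ ≟ᶠ i
          ... | yes refl | yes refl = refl
          ... | yes _    | no p′≢i  = contradiction (sym eq) (ratio≢slope p′≢i p′≢j)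
          ... | no p≢i   | yes _    = contradiction eq (ratio≢slope p≢i p≢j)
          ... | no p≢i   | no p′≢i  = ratio-injective p≢i p≢j p′≢i p′≢j eq

          unit-parameter-i : unit (parameter i) ≡ slope
          unit-parameter-i = trans (cong unit parameter-i) (unit-≢0 slope≢0)

          unit-parameter-j : unit (parameter j) ≡ 1#
          unit-parameter-j = unit-0 (trans (parameter-off (≢-sym i≢j)) ratio-j)

          unit-parameter-k : unit (parameter k) ≡ 1#
          unit-parameter-k = unit-0 (trans (parameter-off (≢-sym i≢k)) ratio-k)

          -- The `q` indices other than `j` give, with the tangent at `i`, different finite
          -- parameters, hence every field element once. Index `j` contributes only the factor 1.
          ∏-parameter : ∏ (unit ∘ parameter) ≡ ∏units
          ∏-parameter = begin
            ∏ (unit ∘ parameter)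
              ≡⟨ Products.sum-remove {i = j} (unit ∘ parameter) ⟩
            unit (parameter j) * ∏ (unit ∘ parameter ∘ punchIn j)
              ≡⟨ cong₂ _*_ unit-parameter-j (∏-bijection unit (λ eq →
                   punchIn-injective j _ _ (parameter-injective (punchInᵢ≢i j _) (punchInᵢ≢i j _) eq))) ⟩
            1# * ∏units
              ≡⟨ *-identityˡ _ ⟩
            ∏units ∎

    open Ratio using (tangent-exists) public

    -- At any further point the parameters in the three pencils are Y/Z, Z/X and X/Y, with product
    -- 1. Multiplying over all points therefore leaves only the three slopes, while each pencil
    -- contributes `∏units`; so the slopes multiply to the cube of `∏units`, which is -1.
    lemma-of-tangents : ∀ {i j k tᵢ tⱼ tₖ} → i ≢ j → i ≢ k → j ≢ k →
      TangentAt i tᵢ → TangentAt j tⱼ → TangentAt k tₖ →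
      dot tᵢ (P k) * (dot tⱼ (P i) * dot tₖ (P j)) ≡ dot tᵢ (P j) * (dot tⱼ (P k) * dot tₖ (P i))
    lemma-of-tangents {i} {j} {k} {tᵢ} {tⱼ} {tₖ} i≢j i≢k j≢k Tᵢ Tⱼ Tₖ = conclude
      where
      module Rᵢ = Ratio i j k
      module Rⱼ = Ratio j k i
      module Rₖ = Ratio k i j
      φᵢ φⱼ φₖ : Fin (suc q) → Carrier
      φᵢ = Rᵢ.parameter i≢j i≢k j≢k Tᵢ
      φⱼ = Rⱼ.parameter j≢k (≢-sym i≢j) (≢-sym i≢k) Tⱼ
      φₖ = Rₖ.parameter (≢-sym i≢k) (≢-sym j≢k) i≢j Tₖ
      sᵢ sⱼ sₖ : Carrier
      sᵢ = Rᵢ.slope i≢j i≢k j≢k Tᵢ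
      sⱼ = Rⱼ.slope j≢k (≢-sym i≢j) (≢-sym i≢k) Tⱼ
      sₖ = Rₖ.slope (≢-sym i≢k) (≢-sym j≢k) i≢j Tₖ

      generic : ∀ X Y Z → X ≢ 0# → Y ≢ 0# → Z ≢ 0# →
                unit (Y * inv Z) * (unit (Z * inv X) * unit (X * inv Y)) ≡ 1#
      generic X Y Z X≢0 Y≢0 Z≢0 = begin
        unit (Y * inv Z) * (unit (Z * inv X) * unit (X * inv Y))
          ≡⟨ cong₂ _*_ (unit-≢0 (*-≢0 Y≢0 (inv-≢0 Z≢0)))
               (cong₂ _*_ (unit-≢0 (*-≢0 Z≢0 (inv-≢0 X≢0))) (unit-≢0 (*-≢0 X≢0 (inv-≢0 Y≢0)))) ⟩
        Y * inv Z * (Z * inv X * (X * inv Y))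
          ≡⟨ solve 6 (λ x y z x′ y′ z′ → y :* z′ :* (z :* x′ :* (x :* y′)) := x :* x′ :* (y :* y′) :* (z :* z′)) refl
               X Y Z (inv X) (inv Y) (inv Z) ⟩
        X * inv X * (Y * inv Y) * (Z * inv Z)
          ≡⟨ cong₂ _*_ (cong₂ _*_ (x*inv-x X≢0) (x*inv-x Y≢0)) (x*inv-x Z≢0) ⟩
        1# * 1# * 1#
          ≡⟨ solve 0 (con (+ 1) :* con (+ 1) :* con (+ 1) := con (+ 1)) refl ⟩
        1# ∎

      δᵢ δⱼ δₖ : Fin (suc q) → Carrier
      δᵢ = pulse i sᵢ
      δⱼ = pulse j sⱼ
      δₖ = pulse k sₖ

      pointwise : ∀ p → unit (φᵢ p) * (unit (φⱼ p) * unit (φₖ p)) ≡ δᵢ p * (δⱼ p * δₖ p)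
      pointwise p = cases (p ≟ᶠ i) (p ≟ᶠ j) (p ≟ᶠ k)
        where
        cases : Dec (p ≡ i) → Dec (p ≡ j) → Dec (p ≡ k) →
                unit (φᵢ p) * (unit (φⱼ p) * unit (φₖ p)) ≡ δᵢ p * (δⱼ p * δₖ p)
        -- At a base point of one pencil, the other two parameters belong to the lines numbered 0
        -- and infinity; both are represented by 0, and `unit` removes them.
        cases (yes refl) _ _ = cong₂ _*_
          (trans (Rᵢ.unit-parameter-i i≢j i≢k j≢k Tᵢ) (sym (Products.pulse-at i sᵢ)))
          (cong₂ _*_
            (trans (Rⱼ.unit-parameter-k j≢k (≢-sym i≢j) (≢-sym i≢k) Tⱼ) (sym (Products.pulse-off sⱼ i≢j)))
            (trans (Rₖ.unit-parameter-j (≢-sym i≢k) (≢-sym j≢k) i≢j Tₖ) (sym (Products.pulse-off sₖ i≢k))))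
        cases (no _) (yes refl) _ = cong₂ _*_
          (trans (Rᵢ.unit-parameter-j i≢j i≢k j≢k Tᵢ) (sym (Products.pulse-off sᵢ (≢-sym i≢j))))
          (cong₂ _*_
            (trans (Rⱼ.unit-parameter-i j≢k (≢-sym i≢j) (≢-sym i≢k) Tⱼ) (sym (Products.pulse-at j sⱼ)))
            (trans (Rₖ.unit-parameter-k (≢-sym i≢k) (≢-sym j≢k) i≢j Tₖ) (sym (Products.pulse-off sₖ j≢k))))
        cases (no _) (no _) (yes refl) = cong₂ _*_
          (trans (Rᵢ.unit-parameter-k i≢j i≢k j≢k Tᵢ) (sym (Products.pulse-off sᵢ (≢-sym i≢k))))
          (cong₂ _*_
            (trans (Rⱼ.unit-parameter-j j≢k (≢-sym i≢j) (≢-sym i≢k) Tⱼ) (sym (Products.pulse-off sⱼ (≢-sym j≢k))))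
            (trans (Rₖ.unit-parameter-i (≢-sym i≢k) (≢-sym j≢k) i≢j Tₖ) (sym (Products.pulse-at k sₖ))))
        cases (no p≢i) (no p≢j) (no p≢k) = begin
          unit (φᵢ p) * (unit (φⱼ p) * unit (φₖ p))
            ≡⟨ cong₂ _*_ (cong unit (Rᵢ.parameter-off i≢j i≢k j≢k Tᵢ p≢i))
                 (cong₂ _*_ (cong unit (Rⱼ.parameter-off j≢k (≢-sym i≢j) (≢-sym i≢k) Tⱼ p≢j))
                            (cong unit (Rₖ.parameter-off (≢-sym i≢k) (≢-sym j≢k) i≢j Tₖ p≢k))) ⟩
          unit (Rᵢ.ratio p) * (unit (Rⱼ.ratio p) * unit (Rₖ.ratio p))
            ≡⟨ generic (det (P j) (P k) (P p)) (det (P k) (P i) (P p)) (det (P i) (P j) (P p))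
                 (arc j≢k (≢-sym p≢j) (≢-sym p≢k)) (arc (≢-sym i≢k) (≢-sym p≢k) (≢-sym p≢i))
                 (arc i≢j (≢-sym p≢i) (≢-sym p≢j)) ⟩
          1#
            ≡⟨ solve 0 (con (+ 1) := con (+ 1) :* (con (+ 1) :* con (+ 1))) refl ⟩
          1# * (1# * 1#)
            ≡⟨ cong₂ _*_ (Products.pulse-off sᵢ p≢i) (cong₂ _*_ (Products.pulse-off sⱼ p≢j) (Products.pulse-off sₖ p≢k)) ⟨
          δᵢ p * (δⱼ p * δₖ p) ∎

      ∏-triple : ∀ (f g h : Fin (suc q) → Carrier) → ∏ (λ p → f p * (g p * h p)) ≡ ∏ f * (∏ g * ∏ h)
      ∏-triple f g h = trans (Products.∑-distrib-+ f (λ p → g p * h p)) (cong (∏ f *_) (Products.∑-distrib-+ g h))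

      slopes : sᵢ * (sⱼ * sₖ) ≡ - 1#
      slopes = begin
        sᵢ * (sⱼ * sₖ)
          ≡⟨ cong₂ _*_ (Products.sum-pulse i sᵢ) (cong₂ _*_ (Products.sum-pulse j sⱼ) (Products.sum-pulse k sₖ)) ⟨
        ∏ δᵢ * (∏ δⱼ * ∏ δₖ)
          ≡⟨ ∏-triple δᵢ δⱼ δₖ ⟨
        ∏ (λ p → δᵢ p * (δⱼ p * δₖ p))
          ≡⟨ Products.sum-cong-≗ pointwise ⟨
        ∏ (λ p → unit (φᵢ p) * (unit (φⱼ p) * unit (φₖ p)))
          ≡⟨ ∏-triple (unit ∘ φᵢ) (unit ∘ φⱼ) (unit ∘ φₖ) ⟩
        ∏ (unit ∘ φᵢ) * (∏ (unit ∘ φⱼ) * ∏ (unit ∘ φₖ))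
          ≡⟨ cong₂ _*_ (Rᵢ.∏-parameter i≢j i≢k j≢k Tᵢ)
               (cong₂ _*_ (Rⱼ.∏-parameter j≢k (≢-sym i≢j) (≢-sym i≢k) Tⱼ)
                          (Rₖ.∏-parameter (≢-sym i≢k) (≢-sym j≢k) i≢j Tₖ)) ⟩
        ∏units * (∏units * ∏units)
          ≡⟨ ∏units³ odd ⟩
        - 1# ∎

      clear : ∀ x y z a b c → x * (y * z) ≡ - 1# → a * (b * c) ≡ - ((x * a) * ((y * b) * (z * c)))
      clear x y z a b c eq = begin
        a * (b * c)
          ≡⟨ solve 3 (λ a b c → a :* (b :* c) := :- (:- con (+ 1) :* (a :* (b :* c)))) refl a b c ⟩
        - (- 1# * (a * (b * c)))
          ≡⟨ cong (λ z → - (z * (a * (b * c)))) eq ⟨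
        - (x * (y * z) * (a * (b * c)))
          ≡⟨ solve 6 (λ x y z a b c → :- (x :* (y :* z) :* (a :* (b :* c))) := :- ((x :* a) :* ((y :* b) :* (z :* c)))) refl x y z a b c ⟩
        - ((x * a) * ((y * b) * (z * c))) ∎

      conclude : dot tᵢ (P k) * (dot tⱼ (P i) * dot tₖ (P j)) ≡ dot tᵢ (P j) * (dot tⱼ (P k) * dot tₖ (P i))
      conclude = begin
        dot tᵢ (P k) * (dot tⱼ (P i) * dot tₖ (P j))
          ≡⟨ solve 3 (λ a b c → a :* (b :* c) := :- (:- a :* (:- b :* :- c))) refl (dot tᵢ (P k)) (dot tⱼ (P i)) (dot tₖ (P j)) ⟩
        - (- dot tᵢ (P k) * (- dot tⱼ (P i) * - dot tₖ (P j)))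
          ≡⟨ cong -_ (cong₂ _*_ (Rᵢ.slope*tⱼ i≢j i≢k j≢k Tᵢ)
               (cong₂ _*_ (Rⱼ.slope*tⱼ j≢k (≢-sym i≢j) (≢-sym i≢k) Tⱼ)
                          (Rₖ.slope*tⱼ (≢-sym i≢k) (≢-sym j≢k) i≢j Tₖ))) ⟨
        - ((sᵢ * dot tᵢ (P j)) * ((sⱼ * dot tⱼ (P k)) * (sₖ * dot tₖ (P i))))
          ≡⟨ clear sᵢ sⱼ sₖ (dot tᵢ (P j)) (dot tⱼ (P k)) (dot tₖ (P i)) slopes ⟨
        dot tᵢ (P j) * (dot tⱼ (P k) * dot tₖ (P i)) ∎

-- Segre's theorem: the conic of an arc and its dual.

module Segre {q : ℕ} (F : FiniteField q) (odd : Odd q) where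
  open Vectors F
  open Arcs F odd
  open ≡-Reasoning

  module SegreArc (P : Fin (suc q) → Vec3)
             (arc : ∀ {i j k} → i ≢ j → i ≢ k → j ≢ k → det (P i) (P j) (P k) ≢ 0#) where
    open Arc P arc
    open TangentAt

    -- With fixed tangents at `P j` and `P k`, the lemma of tangents determines the ratio of the
    -- values of a tangent at these two points; its value at `P i` is 0, so the tangent is
    -- determined up to a factor.
    tangent-unique : ∀ {i j k t t′} → i ≢ j → i ≢ k → j ≢ k → TangentAt i t → TangentAt i t′ →
                     ∀ y → dot t′ (P j) * dot t y ≡ dot t (P j) * dot t′ y
    tangent-unique {i} {j} {k} {t} {t′} i≢j i≢k j≢k T T′ y =
      *-cancelˡ (arc i≢j i≢k j≢k) (begin
        D * (t′j * dot t y)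
          ≡⟨ solve 3 (λ d b y → d :* (b :* y) := b :* (d :* y)) refl D t′j (dot t y) ⟩
        t′j * (D * dot t y)
          ≡⟨ cong (t′j *_) (expand T) ⟩
        t′j * (tj * Y + tk * Z)
          ≡⟨ solve 5 (λ b′ b y c z → b′ :* (b :* y :+ c :* z) := b :* b′ :* y :+ c :* b′ :* z) refl t′j tj Y tk Z ⟩
        tj * t′j * Y + tk * t′j * Z
          ≡⟨ cong (λ w → tj * t′j * Y + w * Z) same-slope ⟩
        tj * t′j * Y + tj * t′k * Z
          ≡⟨ solve 5 (λ b b′ y c z → b :* b′ :* y :+ b :* c :* z := b :* (b′ :* y :+ c :* z)) refl tj t′j Y t′k Z ⟩
        tj * (t′j * Y + t′k * Z)
          ≡⟨ cong (tj *_) (expand T′) ⟨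
        tj * (D * dot t′ y)
          ≡⟨ solve 3 (λ d b y → b :* (d :* y) := d :* (b :* y)) refl D tj (dot t′ y) ⟩
        D * (tj * dot t′ y) ∎)
      where
      D = det (P i) (P j) (P k)
      X = det (P j) (P k) y
      Y = det (P k) (P i) y
      Z = det (P i) (P j) y
      tj = dot t (P j)
      tk = dot t (P k)
      t′j = dot t′ (P j)
      t′k = dot t′ (P k)

      expand : ∀ {l} → TangentAt i l → D * dot l y ≡ dot l (P j) * Y + dot l (P k) * Z
      expand {l} L = trans (cramer (P i) (P j) (P k) l y) (trans
        (cong (λ w → w * X + dot l (P j) * Y + dot l (P k) * Z) (meets L))
        (solve 3 (λ x u v → con (+ 0) :* x :+ u :+ v := u :+ v) refl X (dot l (P j) * Y) (dot l (P k) * Z)))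

      Tⱼ = tangent-exists j i k (≢-sym i≢j) j≢k i≢k
      Tₖ = tangent-exists k i j (≢-sym i≢k) (≢-sym j≢k) i≢j
      U V : Carrier
      U = dot (proj₁ Tⱼ) (P i) * dot (proj₁ Tₖ) (P j)
      V = dot (proj₁ Tⱼ) (P k) * dot (proj₁ Tₖ) (P i)

      same-slope : tk * t′j ≡ tj * t′k
      same-slope = *-cancelˡ (*-≢0 (misses (proj₂ Tⱼ) i≢j) (misses (proj₂ Tₖ) j≢k)) (begin
        U * (tk * t′j)  ≡⟨ solve 3 (λ u c b → u :* (c :* b) := c :* u :* b) refl U tk t′j ⟩
        tk * U * t′j    ≡⟨ cong (_* t′j) (lemma-of-tangents i≢j i≢k j≢k T (proj₂ Tⱼ) (proj₂ Tₖ)) ⟩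
        tj * V * t′j    ≡⟨ solve 3 (λ b v b′ → b :* v :* b′ := b′ :* v :* b) refl tj V t′j ⟩
        t′j * V * tj    ≡⟨ cong (_* tj) (lemma-of-tangents i≢j i≢k j≢k T′ (proj₂ Tⱼ) (proj₂ Tₖ)) ⟨
        t′k * U * tj    ≡⟨ solve 3 (λ c u b → c :* u :* b := u :* (b :* c)) refl t′k U tj ⟩
        U * (tj * t′k)  ∎)

    -- Rescale the three tangents so that tᵢ (P j) = tⱼ (P i), and so on.  By the lemma of tangents the
    -- tangent at any further point x of the arc is then, up to a factor, the form B(x,-), where B is
    -- the symmetric bilinear form with B(P i,-) = tᵢ, B(P j,-) = tⱼ and B(P k,-) = tₖ.
    module Triangle {i j k tᵢ tⱼ tₖ} (i≢j : i ≢ j) (i≢k : i ≢ k) (j≢k : j ≢ k)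
                    (Tᵢ : TangentAt i tᵢ) (Tⱼ : TangentAt j tⱼ) (Tₖ : TangentAt k tₖ) where
      D p p′ r s u v : Carrier
      D = det (P i) (P j) (P k)
      p = dot tᵢ (P j)
      p′ = dot tᵢ (P k)
      r = dot tⱼ (P i)
      s = dot tⱼ (P k)
      u = dot tₖ (P i)
      v = dot tₖ (P j)

      D≢0 : D ≢ 0#
      D≢0 = arc i≢j i≢k j≢k
      p≢0 : p ≢ 0#
      p≢0 = misses Tᵢ (≢-sym i≢j)
      p′≢0 : p′ ≢ 0#
      p′≢0 = misses Tᵢ (≢-sym i≢k)
      r≢0 : r ≢ 0#
      r≢0 = misses Tⱼ i≢j
      s≢0 : s ≢ 0#
      s≢0 = misses Tⱼ (≢-sym j≢k)
      u≢0 : u ≢ 0#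
      u≢0 = misses Tₖ i≢k

      X Y Z : Vec3 → Carrier
      X y = det (P j) (P k) y
      Y y = det (P k) (P i) y
      Z y = det (P i) (P j) y

      symmetry : p′ * (r * v) ≡ p * (s * u)
      symmetry = lemma-of-tangents i≢j i≢k j≢k Tᵢ Tⱼ Tₖ

      D*tᵢ : ∀ y → D * dot tᵢ y ≡ p * Y y + p′ * Z y
      D*tᵢ y = trans (cramer (P i) (P j) (P k) tᵢ y) (trans
        (cong (λ w → w * X y + p * Y y + p′ * Z y) (meets Tᵢ))
        (solve 3 (λ x u v → con (+ 0) :* x :+ u :+ v := u :+ v) refl (X y) (p * Y y) (p′ * Z y)))

      D*tⱼ : ∀ y → D * dot tⱼ y ≡ r * X y + s * Z y
      D*tⱼ y = trans (cramer (P i) (P j) (P k) tⱼ y) (trans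
        (cong (λ w → r * X y + w * Y y + s * Z y) (meets Tⱼ))
        (solve 3 (λ x u v → u :+ con (+ 0) :* x :+ v := u :+ v) refl (Y y) (r * X y) (s * Z y)))

      D*tₖ : ∀ y → D * dot tₖ y ≡ u * X y + v * Y y
      D*tₖ y = trans (cramer (P i) (P j) (P k) tₖ y) (trans
        (cong (λ w → u * X y + v * Y y + w * Z y) (meets Tₖ))
        (solve 3 (λ x u v → u :+ v :+ con (+ 0) :* x := u :+ v) refl (Z y) (u * X y) (v * Y y)))

      -- The factors `r * u`, `u * p`, `r * p′` are the rescalings of the tangents. They make the
      -- values for the pairs i, j and i, k agree identically (`r * u * p` and `r * u * p′`); for j,
      -- k the values `u * p * s` and `r * p′ * v` agree by `symmetry`.
      form : Vec3 → Vec3 → Carrier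
      form x y = r * u * X x * dot tᵢ y + u * p * Y x * dot tⱼ y + r * p′ * Z x * dot tₖ y

      -- The left-hand side is `form y x` with its factors reordered. Only the pair j, k obstructs
      -- symmetry, so the difference is a multiple of the two sides of `symmetry` subtracted.
      form-symmetric : ∀ x y → r * u * dot tᵢ x * X y + u * p * dot tⱼ x * Y y + r * p′ * dot tₖ x * Z y ≡ form x y
      form-symmetric x y = *-cancelˡ D≢0 (begin
        D * (r * u * dot tᵢ x * X y + u * p * dot tⱼ x * Y y + r * p′ * dot tₖ x * Z y)
          ≡⟨ distribute _ _ _ _ _ _ _ ⟩
        r * u * X y * (D * dot tᵢ x) + u * p * Y y * (D * dot tⱼ x) + r * p′ * Z y * (D * dot tₖ x)
          ≡⟨ cong₂ _+_ (cong₂ _+_ (cong (r * u * X y *_) (D*tᵢ x)) (cong (u * p * Y y *_) (D*tⱼ x)))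
                       (cong (r * p′ * Z y *_) (D*tₖ x)) ⟩
        r * u * X y * (p * Y x + p′ * Z x) + u * p * Y y * (r * X x + s * Z x) + r * p′ * Z y * (u * X x + v * Y x)
          ≡⟨ solve 12 (λ p p′ r s u v x y z x′ y′ z′ →
               r :* u :* x′ :* (p :* y :+ p′ :* z) :+ u :* p :* y′ :* (r :* x :+ s :* z) :+ r :* p′ :* z′ :* (u :* x :+ v :* y) :=
               r :* u :* x :* (p :* y′ :+ p′ :* z′) :+ u :* p :* y :* (r :* x′ :+ s :* z′) :+ r :* p′ :* z :* (u :* x′ :+ v :* y′)
                 :+ (y :* z′ :- z :* y′) :* (p′ :* (r :* v) :- p :* (s :* u)))
               refl p p′ r s u v (X x) (Y x) (Z x) (X y) (Y y) (Z y) ⟩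
        expanded + (Y x * Z y - Z x * Y y) * (p′ * (r * v) - p * (s * u))
          ≡⟨ cong (λ w → expanded + (Y x * Z y - Z x * Y y) * w) (x≡y⇒x-y≡0 symmetry) ⟩
        expanded + (Y x * Z y - Z x * Y y) * 0#
          ≡⟨ cong (λ w → expanded + w) (zeroʳ _) ⟩
        expanded + 0#
          ≡⟨ +-identityʳ expanded ⟩
        expanded
          ≡⟨ cong₂ _+_ (cong₂ _+_ (cong (r * u * X x *_) (D*tᵢ y)) (cong (u * p * Y x *_) (D*tⱼ y)))
                       (cong (r * p′ * Z x *_) (D*tₖ y)) ⟨
        r * u * X x * (D * dot tᵢ y) + u * p * Y x * (D * dot tⱼ y) + r * p′ * Z x * (D * dot tₖ y)
          ≡⟨ collect _ _ _ _ _ _ _ ⟩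
        D * form x y ∎)
        where
        expanded : Carrier
        expanded = r * u * X x * (p * Y y + p′ * Z y) + u * p * Y x * (r * X y + s * Z y) + r * p′ * Z x * (u * X y + v * Y y)
        distribute : ∀ d a b c e f g → d * (r * u * a * b + u * p * c * e + r * p′ * f * g) ≡
                     r * u * b * (d * a) + u * p * e * (d * c) + r * p′ * g * (d * f)
        distribute d a b c e f g = solve 11 (λ p p′ r u d a b c e f g →
          d :* (r :* u :* a :* b :+ u :* p :* c :* e :+ r :* p′ :* f :* g) :=
          r :* u :* b :* (d :* a) :+ u :* p :* e :* (d :* c) :+ r :* p′ :* g :* (d :* f))
          refl p p′ r u d a b c e f g
        collect : ∀ d a b c e f g → r * u * a * (d * b) + u * p * c * (d * e) + r * p′ * f * (d * g) ≡
                  d * (r * u * a * b + u * p * c * e + r * p′ * f * g)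
        collect d a b c e f g = solve 11 (λ p p′ r u d a b c e f g →
          r :* u :* a :* (d :* b) :+ u :* p :* c :* (d :* e) :+ r :* p′ :* f :* (d :* g) :=
          d :* (r :* u :* a :* b :+ u :* p :* c :* e :+ r :* p′ :* f :* g))
          refl p p′ r u d a b c e f g

      -- The diagonal of `form`: after `v` is eliminated by `symmetry`, D times `form x x` equals 2u
      -- times this polynomial.
      conic : Vec3 → Carrier
      conic x = p * s * (Y x * Z x) + r * p′ * (X x * Z x) + r * p * (X x * Y x)

      module _ {x t} (x≢i : x ≢ i) (x≢j : x ≢ j) (x≢k : x ≢ k) (T : TangentAt x t) where

        -- The lemma of tangents for the triples i, j, x and i, k, x expresses `dot t (P j)` and
        -- `dot t (P k)` through `dot t (P i)`, and these three values determine `t`.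
        tangent-is-polar : ∀ y → r * u * dot tᵢ (P x) * D * dot t y ≡ dot t (P i) * form (P x) y
        tangent-is-polar y = begin
          r * u * τ * D * dot t y
            ≡⟨ solve 5 (λ r u τ d t → r :* u :* τ :* d :* t := r :* u :* τ :* (d :* t)) refl r u τ D (dot t y) ⟩
          r * u * τ * (D * dot t y)
            ≡⟨ cong (r * u * τ *_) (cramer (P i) (P j) (P k) t y) ⟩
          r * u * τ * (dot t (P i) * X y + dot t (P j) * Y y + dot t (P k) * Z y)
            ≡⟨ solve 9 (λ r u τ a x b y c z → r :* u :* τ :* (a :* x :+ b :* y :+ c :* z) :=
                  r :* u :* τ :* a :* x :+ u :* y :* (τ :* (r :* b)) :+ r :* z :* (τ :* (u :* c)))
                  refl r u τ (dot t (P i)) (X y) (dot t (P j)) (Y y) (dot t (P k)) (Z y) ⟩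
          r * u * τ * dot t (P i) * X y + u * Y y * (τ * (r * dot t (P j))) + r * Z y * (τ * (u * dot t (P k)))
            ≡⟨ cong₂ (λ w w′ → r * u * τ * dot t (P i) * X y + u * Y y * w + r * Z y * w′)
                  (lemma-of-tangents i≢j (≢-sym x≢i) (≢-sym x≢j) Tᵢ Tⱼ T)
                  (lemma-of-tangents i≢k (≢-sym x≢i) (≢-sym x≢k) Tᵢ Tₖ T) ⟩
          r * u * τ * dot t (P i) * X y + u * Y y * (p * (dot tⱼ (P x) * dot t (P i))) + r * Z y * (p′ * (dot tₖ (P x) * dot t (P i)))
            ≡⟨ solve 11 (λ r u τ a x y p j z p′ k →
                  r :* u :* τ :* a :* x :+ u :* y :* (p :* (j :* a)) :+ r :* z :* (p′ :* (k :* a)) :=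
                  a :* (r :* u :* τ :* x :+ u :* p :* j :* y :+ r :* p′ :* k :* z))
                  refl r u τ (dot t (P i)) (X y) (Y y) p (dot tⱼ (P x)) (Z y) p′ (dot tₖ (P x)) ⟩
          dot t (P i) * (r * u * τ * X y + u * p * dot tⱼ (P x) * Y y + r * p′ * dot tₖ (P x) * Z y)
            ≡⟨ cong (dot t (P i) *_) (form-symmetric (P x) y) ⟩
          dot t (P i) * form (P x) y ∎
          where
          τ = dot tᵢ (P x)

        -- The point lies on its own tangent, hence on its own polar; the factor 2 in the diagonal
        -- of `form` cancels because `q` is odd.
        conic-vanishes : conic (P x) ≡ 0#
        conic-vanishes = xy≡0⇒y≡0 (*-≢0 (1+1≢0 odd) u≢0) (begin
          (1# + 1#) * u * conic (P x)
            ≡⟨ solve 9 (λ p p′ r s u v x y z →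
                 (con (+ 1) :+ con (+ 1)) :* u :* (p :* s :* (y :* z) :+ r :* p′ :* (x :* z) :+ r :* p :* (x :* y)) :=
                 r :* u :* x :* (p :* y :+ p′ :* z) :+ u :* p :* y :* (r :* x :+ s :* z) :+ r :* p′ :* z :* (u :* x :+ v :* y)
                   :- y :* z :* (p′ :* (r :* v) :- p :* (s :* u)))
                 refl p p′ r s u v x₀ y₀ z₀ ⟩
          expanded - y₀ * z₀ * (p′ * (r * v) - p * (s * u))
            ≡⟨ cong₂ (λ w w′ → w - y₀ * z₀ * w′) expanded≡0 (x≡y⇒x-y≡0 symmetry) ⟩
          0# - y₀ * z₀ * 0#
            ≡⟨ solve 1 (λ w → con (+ 0) :- w :* con (+ 0) := con (+ 0)) refl (y₀ * z₀) ⟩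
          0# ∎)
          where
          x₀ = X (P x)
          y₀ = Y (P x)
          z₀ = Z (P x)
          expanded : Carrier
          expanded = r * u * x₀ * (p * y₀ + p′ * z₀) + u * p * y₀ * (r * x₀ + s * z₀) + r * p′ * z₀ * (u * x₀ + v * y₀)
          form≡0 : form (P x) (P x) ≡ 0#
          form≡0 = xy≡0⇒y≡0 (misses T (≢-sym x≢i)) (begin
            dot t (P i) * form (P x) (P x)             ≡⟨ tangent-is-polar (P x) ⟨
            r * u * dot tᵢ (P x) * D * dot t (P x)     ≡⟨ cong (r * u * dot tᵢ (P x) * D *_) (meets T) ⟩
            r * u * dot tᵢ (P x) * D * 0#              ≡⟨ zeroʳ _ ⟩
            0#                                         ∎)
          expanded≡0 : expanded ≡ 0#
          expanded≡0 = begin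
            expanded
              ≡⟨ cong₂ _+_ (cong₂ _+_ (cong (r * u * x₀ *_) (D*tᵢ (P x))) (cong (u * p * y₀ *_) (D*tⱼ (P x))))
                           (cong (r * p′ * z₀ *_) (D*tₖ (P x))) ⟨
            r * u * x₀ * (D * dot tᵢ (P x)) + u * p * y₀ * (D * dot tⱼ (P x)) + r * p′ * z₀ * (D * dot tₖ (P x))
              ≡⟨ solve 11 (λ p p′ r u d a b c e f g →
                  r :* u :* a :* (d :* b) :+ u :* p :* c :* (d :* e) :+ r :* p′ :* f :* (d :* g) :=
                  d :* (r :* u :* a :* b :+ u :* p :* c :* e :+ r :* p′ :* f :* g))
                  refl p p′ r u D x₀ (dot tᵢ (P x)) y₀ (dot tⱼ (P x)) z₀ (dot tₖ (P x)) ⟩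
            D * form (P x) (P x)
              ≡⟨ cong (D *_) form≡0 ⟩
            D * 0#
              ≡⟨ zeroʳ D ⟩
            0# ∎

        -- The tangents satisfy, in coordinates with respect to tᵢ, tⱼ and tₖ, the equation of the arc;
        -- those coordinates are proportional to the values at the vertices A, B, C of the triangle
        -- with sides tᵢ, tⱼ and tₖ.
        dual-conic-vanishes : ∀ {A B C} →
          dot tᵢ B ≡ 0# → dot tᵢ C ≡ 0# → dot tⱼ C ≡ 0# → dot tⱼ A ≡ 0# → dot tₖ A ≡ 0# → dot tₖ B ≡ 0# →
          dot tᵢ A * s * u * (dot t B * dot t C) + dot tⱼ B * u * p′ * (dot t A * dot t C)
            + dot tₖ C * r * p′ * (dot t A * dot t B) ≡ 0#
        dual-conic-vanishes {A} {B} {C} iB iC jC jA kA kB = xy≡0⇒y≡0 (*-≢0 K≢0 K≢0) (begin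
          K * K * (α * s * u * (dot t B * dot t C) + β * u * p′ * (dot t A * dot t C) + γ * r * p′ * (dot t A * dot t B))
            ≡⟨ solve 11 (λ k a s u b p′ g r x y z →
                 k :* k :* (a :* s :* u :* (y :* z) :+ b :* u :* p′ :* (x :* z) :+ g :* r :* p′ :* (x :* y)) :=
                 a :* s :* u :* ((k :* y) :* (k :* z)) :+ b :* u :* p′ :* ((k :* x) :* (k :* z)) :+ g :* r :* p′ :* ((k :* x) :* (k :* y)))
                 refl K α s u β p′ γ r (dot t A) (dot t B) (dot t C) ⟩
          α * s * u * ((K * dot t B) * (K * dot t C)) + β * u * p′ * ((K * dot t A) * (K * dot t C)) + γ * r * p′ * ((K * dot t A) * (K * dot t B))
            ≡⟨ substitute _ _ _ _ _ _ KA KB KC ⟩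
          α * s * u * ((m * (u * p * Y (P x) * β)) * (m * (r * p′ * Z (P x) * γ)))
            + β * u * p′ * ((m * (r * u * X (P x) * α)) * (m * (r * p′ * Z (P x) * γ)))
            + γ * r * p′ * ((m * (r * u * X (P x) * α)) * (m * (u * p * Y (P x) * β)))
            ≡⟨ solve 12 (λ a b g s u p′ r p m x y z →
                 a :* s :* u :* ((m :* (u :* p :* y :* b)) :* (m :* (r :* p′ :* z :* g)))
                   :+ b :* u :* p′ :* ((m :* (r :* u :* x :* a)) :* (m :* (r :* p′ :* z :* g)))
                   :+ g :* r :* p′ :* ((m :* (r :* u :* x :* a)) :* (m :* (u :* p :* y :* b))) :=
                 m :* m :* a :* b :* g :* u :* u :* r :* p′ :*
                   (p :* s :* (y :* z) :+ r :* p′ :* (x :* z) :+ r :* p :* (x :* y)))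
                 refl α β γ s u p′ r p m (X (P x)) (Y (P x)) (Z (P x)) ⟩
          -- The coefficients of the dual equation are those for which the three terms acquire a
          -- common factor and leave exactly the equation of the arc.
          m * m * α * β * γ * u * u * r * p′ * conic (P x)
            ≡⟨ cong (m * m * α * β * γ * u * u * r * p′ *_) conic-vanishes ⟩
          m * m * α * β * γ * u * u * r * p′ * 0#
            ≡⟨ zeroʳ _ ⟩
          0# ∎)
          where
          α = dot tᵢ A
          β = dot tⱼ B
          γ = dot tₖ C
          m = dot t (P i)
          K = r * u * dot tᵢ (P x) * D
          K≢0 : K ≢ 0#
          K≢0 = *-≢0 (*-≢0 (*-≢0 r≢0 u≢0) (misses Tᵢ x≢i)) D≢0
          substitute : ∀ a b c a′ b′ c′ → a ≡ a′ → b ≡ b′ → c ≡ c′ →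
            α * s * u * (b * c) + β * u * p′ * (a * c) + γ * r * p′ * (a * b) ≡
            α * s * u * (b′ * c′) + β * u * p′ * (a′ * c′) + γ * r * p′ * (a′ * b′)
          substitute _ _ _ _ _ _ refl refl refl = refl
          KA : K * dot t A ≡ m * (r * u * X (P x) * α)
          KA = trans (tangent-is-polar A) (trans
            (cong₂ (λ w w′ → m * (r * u * X (P x) * α + u * p * Y (P x) * w + r * p′ * Z (P x) * w′)) jA kA)
            (solve 4 (λ m a b c → m :* (a :+ b :* con (+ 0) :+ c :* con (+ 0)) := m :* a) refl
              m (r * u * X (P x) * α) (u * p * Y (P x)) (r * p′ * Z (P x))))
          KB : K * dot t B ≡ m * (u * p * Y (P x) * β)
          KB = trans (tangent-is-polar B) (trans
            (cong₂ (λ w w′ → m * (r * u * X (P x) * w + u * p * Y (P x) * β + r * p′ * Z (P x) * w′)) iB kB)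
            (solve 4 (λ m a b c → m :* (b :* con (+ 0) :+ a :+ c :* con (+ 0)) := m :* a) refl
              m (u * p * Y (P x) * β) (r * u * X (P x)) (r * p′ * Z (P x))))
          KC : K * dot t C ≡ m * (r * p′ * Z (P x) * γ)
          KC = trans (tangent-is-polar C) (trans
            (cong₂ (λ w w′ → m * (r * u * X (P x) * w + u * p * Y (P x) * w′ + r * p′ * Z (P x) * γ)) iC jC)
            (solve 4 (λ m a b c → m :* (b :* con (+ 0) :+ c :* con (+ 0) :+ a) := m :* a) refl
              m (r * p′ * Z (P x) * γ) (r * u * X (P x)) (u * p * Y (P x))))

-- Odd prime powers are odd.

parity : ∀ n → (∃ λ k → n ≡ k ℕ.+ k) ⊎ Odd n
parity zero = inj₁ (0 , refl)
parity (suc n) with parity n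
... | inj₁ (k , refl) = inj₂ (k , refl)
... | inj₂ (k , refl) = inj₁ (suc k , cong suc (sym (ℕₚ.+-suc k k)))

odd-* : ∀ {m n} → Odd m → Odd n → Odd (m ℕ.* n)
odd-* (a , refl) (b , refl) = a ℕ.+ b ℕ.+ 2 ℕ.* (a ℕ.* b) ,
  solve 2 (λ a b → (con 1 :+ (a :+ a)) :* (con 1 :+ (b :+ b)) :=
    con 1 :+ ((a :+ b :+ con 2 :* (a :* b)) :+ (a :+ b :+ con 2 :* (a :* b)))) refl a b
  where open +-*-Solver

odd-^ : ∀ {p} → Odd p → ∀ k → Odd (p ^ k)
odd-^ p-odd zero    = 0 , refl
odd-^ p-odd (suc k) = odd-* p-odd (odd-^ p-odd k)

odd-prime : ∀ {p} → Prime p → p ≢ 2 → Odd p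
odd-prime {p} p-prime p≢2 with parity p
... | inj₂ p-odd = p-odd
... | inj₁ (k , refl) with prime⇒irreducible p-prime (divides k (trans (cong (k ℕ.+_) (sym (ℕₚ.+-identityʳ k))) (ℕₚ.*-comm 2 k)))
...   | inj₂ 2≡p = contradiction (sym 2≡p) p≢2

oddPrimePower⇒odd : ∀ {q} → OddPrimePower q → Odd q
oddPrimePower⇒odd (p , k , p-prime , p≢2 , _ , refl) = odd-^ (odd-prime p-prime p≢2) k

two-others : ∀ {n} → 2 ≤ n → (i : Fin (suc n)) → ∃ λ j → ∃ λ k → i ≢ j × i ≢ k × j ≢ k
two-others (s≤s (s≤s _)) i = punchIn i 0F , punchIn i 1F , ≢-sym (punchInᵢ≢i i 0F) , ≢-sym (punchInᵢ≢i i 1F) ,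
  λ eq → contradiction (punchIn-injective i 0F 1F eq) λ ()

-- Ovals and the frame given by a Poncelet triangle.

module Ovals {q : ℕ} (F : FiniteField q) (odd : Odd q) where
  open Vectors F
  open Arcs F odd
  open Segre F odd
  open ≡-Reasoning

  cross-zero⇒same : ∀ (P Q : Point) → IsZero (cross (proj₁ P) (proj₁ Q)) → SamePoint P Q
  cross-zero⇒same (a , a≢0) (b , b≢0) (z₀ , z₁ , z₂) = cases (c₀ a ≟ 0#) (c₁ a ≟ 0#) (c₂ a ≟ 0#)
    where
    by-coordinate : ∀ {x y} → x ≢ 0# → x * c₀ b ≡ c₀ a * y → x * c₁ b ≡ c₁ a * y → x * c₂ b ≡ c₂ a * y →
                    SamePoint (a , a≢0) (b , b≢0)
    by-coordinate {x} {y} x≢0 e₀ e₁ e₂ = y * inv x , factor≢0 , vector (factor e₀) (factor e₁) (factor e₂)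
      where
      factor : ∀ {s t} → x * t ≡ s * y → y * inv x * s ≡ t
      factor {s} {t} e = *-cancelˡ x≢0 (begin
        x * (y * inv x * s)    ≡⟨ solve 4 (λ x y i s → x :* (y :* i :* s) := x :* i :* (s :* y)) refl x y (inv x) s ⟩
        x * inv x * (s * y)    ≡⟨ cong (_* (s * y)) (x*inv-x x≢0) ⟩
        1# * (s * y)           ≡⟨ *-identityˡ _ ⟩
        s * y                  ≡⟨ e ⟨
        x * t                  ∎)
      factor≢0 : y * inv x ≢ 0#
      factor≢0 eq = b≢0 (vanish e₀ , vanish e₁ , vanish e₂)
        where
        vanish : ∀ {s t} → x * t ≡ s * y → t ≡ 0#
        vanish {s} e = trans (sym (factor e)) (trans (cong (_* s) eq) (zeroˡ s))
      vector : ∀ {s₀ s₁ s₂ t₀ t₁ t₂} → s₀ ≡ t₀ → s₁ ≡ t₁ → s₂ ≡ t₂ → ⟨ s₀ , s₁ , s₂ ⟩ ≡ ⟨ t₀ , t₁ , t₂ ⟩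
      vector refl refl refl = refl

    cases : Dec (c₀ a ≡ 0#) → Dec (c₁ a ≡ 0#) → Dec (c₂ a ≡ 0#) → SamePoint (a , a≢0) (b , b≢0)
    cases (no x≢0) _ _ = by-coordinate x≢0 refl (x-y≡0⇒x≡y z₂) (sym (x-y≡0⇒x≡y z₁))
    cases (yes _) (no x≢0) _ = by-coordinate x≢0 (sym (x-y≡0⇒x≡y z₂)) refl (x-y≡0⇒x≡y z₀)
    cases (yes _) (yes _) (no x≢0) = by-coordinate x≢0 (x-y≡0⇒x≡y z₁) (sym (x-y≡0⇒x≡y z₀)) refl
    cases (yes x≡0) (yes y≡0) (yes z≡0) = contradiction (x≡0 , y≡0 , z≡0) a≢0

  coordinates : Oval → Fin (suc q) → Vec3
  coordinates O i = proj₁ (pt O i)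

  -- The cross product of two points is a genuine line because the points of an oval are
  -- projectively distinct; a zero determinant would put the third point on it.
  oval-arc : ∀ O {i j k} → i ≢ j → i ≢ k → j ≢ k →
             det (coordinates O i) (coordinates O j) (coordinates O k) ≢ 0#
  oval-arc O {i} {j} {k} i≢j i≢k j≢k det≡0 = noThree O i j k i≢j i≢k j≢k
    ((cross (coordinates O i) (coordinates O j) , λ zero → i≢j (distinct O i j (cross-zero⇒same (pt O i) (pt O j) zero))) ,
     det-aba (coordinates O i) (coordinates O j) , det-abb (coordinates O i) (coordinates O j) , det≡0)

  Through : Oval → Line → Fin (suc q) → Set
  Through O L i = Incident (pt O i) L

  module PonceletTriangle (Oₜ Oₛ : Oval) (triangle : PonceletPolygon Oₜ Oₛ 3) where
    open PonceletPolygon triangle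
    module T = Arc (coordinates Oₜ) (oval-arc Oₜ)
    module S = Arc (coordinates Oₛ) (oval-arc Oₛ)
    module TS = SegreArc (coordinates Oₜ) (oval-arc Oₜ)
    module SS = SegreArc (coordinates Oₛ) (oval-arc Oₛ)

    Side : Fin (suc q) → Fin (suc q) → Set
    Side m n = Σ Line λ L → Through Oₛ L m × Through Oₛ L n × Tangent Oₜ L

    side-sym : ∀ {m n} → Side m n → Side n m
    side-sym (L , Lm , Ln , T) = L , Ln , Lm , T

    tangentAt : (L : Line) (T : Tangent Oₜ L) → T.TangentAt (proj₁ T) (proj₁ L)
    tangentAt L (i , Li , only) = record { meets = Li ; misses = λ j≢i Lj → j≢i (only _ Lj) }

    third-off : ∀ (L : Line) {l m n} → l ≢ m → l ≢ n → m ≢ n → Through Oₛ L m → Through Oₛ L n → ¬ Through Oₛ L l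
    third-off L l≢m l≢n m≢n Lm Ln Ll = noThree Oₛ _ _ _ l≢m l≢n m≢n (L , Ll , Lm , Ln)

    a≢b : vertex 0F ≢ vertex 1F
    a≢b eq = contradiction (injective eq) λ ()
    a≢c : vertex 0F ≢ vertex 2F
    a≢c eq = contradiction (injective eq) λ ()
    b≢c : vertex 1F ≢ vertex 2F
    b≢c eq = contradiction (injective eq) λ ()

    A B C : Vec3
    A = coordinates Oₛ (vertex 0F)
    B = coordinates Oₛ (vertex 1F)
    C = coordinates Oₛ (vertex 2F)

    AB BC CA : Line
    AB = proj₁ (sides 0F)
    BC = proj₁ (sides 1F)
    CA = proj₁ (sides 2F)

    AB-A : dot (proj₁ AB) A ≡ 0#
    AB-A = proj₁ (proj₂ (sides 0F))
    AB-B : dot (proj₁ AB) B ≡ 0#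
    AB-B = proj₁ (proj₂ (proj₂ (sides 0F)))
    BC-B : dot (proj₁ BC) B ≡ 0#
    BC-B = proj₁ (proj₂ (sides 1F))
    BC-C : dot (proj₁ BC) C ≡ 0#
    BC-C = proj₁ (proj₂ (proj₂ (sides 1F)))
    CA-C : dot (proj₁ CA) C ≡ 0#
    CA-C = proj₁ (proj₂ (sides 2F))
    CA-A : dot (proj₁ CA) A ≡ 0#
    CA-A = proj₁ (proj₂ (proj₂ (sides 2F)))

    AB-C : dot (proj₁ AB) C ≢ 0#
    AB-C = third-off AB (≢-sym a≢c) (≢-sym b≢c) a≢b AB-A AB-B
    BC-A : dot (proj₁ BC) A ≢ 0#
    BC-A = third-off BC a≢b a≢c b≢c BC-B BC-C
    CA-B : dot (proj₁ CA) B ≢ 0#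
    CA-B = third-off CA b≢c (≢-sym a≢b) (≢-sym a≢c) CA-C CA-A

    tangent-AB : Tangent Oₜ AB
    tangent-AB = proj₂ (proj₂ (proj₂ (sides 0F)))
    tangent-BC : Tangent Oₜ BC
    tangent-BC = proj₂ (proj₂ (proj₂ (sides 1F)))
    tangent-CA : Tangent Oₜ CA
    tangent-CA = proj₂ (proj₂ (proj₂ (sides 2F)))

    -- Tangents with the same contact point are proportional, so `y` cannot separate them. Thus the
    -- three sides touch `Oₜ` at different points, which can serve as the triangle for Segre's
    -- equations.
    contacts-distinct : ∀ {i j t t′ y} → T.TangentAt i t → T.TangentAt j t′ →
                        dot t y ≡ 0# → dot t′ y ≢ 0# → i ≢ j
    contacts-distinct {i} {_} {t} {t′} {y} T T′ ty≡0 t′y≢0 refl =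
      -- For the given triangle `m≤q+1` reads `3 ≤ suc q`, which supplies the two further points.
      let j , k , i≢j , i≢k , j≢k = two-others (ℕₚ.≤-pred m≤q+1) i in
      *-≢0 (T.TangentAt.misses T (≢-sym i≢j)) t′y≢0
        (trans (sym (TS.tangent-unique i≢j i≢k j≢k T T′ y))
          (trans (cong (dot t′ (coordinates Oₜ j) *_) ty≡0) (zeroʳ _)))

    i j k : Fin (suc q)
    i = proj₁ tangent-BC
    j = proj₁ tangent-CA
    k = proj₁ tangent-AB

    i≢j : i ≢ j
    i≢j = contacts-distinct (tangentAt BC tangent-BC) (tangentAt CA tangent-CA) BC-B CA-B
    i≢k : i ≢ k
    i≢k = contacts-distinct (tangentAt BC tangent-BC) (tangentAt AB tangent-AB) BC-C AB-C
    j≢k : j ≢ k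
    j≢k = contacts-distinct (tangentAt CA tangent-CA) (tangentAt AB tangent-AB) CA-C AB-C

    module Dual = TS.Triangle i≢j i≢k j≢k (tangentAt BC tangent-BC) (tangentAt CA tangent-CA) (tangentAt AB tangent-AB)
    module Primal = SS.Triangle a≢b a≢c b≢c
      (proj₂ (S.tangent-exists _ _ _ a≢b a≢c b≢c))
      (proj₂ (S.tangent-exists _ _ _ (≢-sym a≢b) b≢c a≢c))
      (proj₂ (S.tangent-exists _ _ _ (≢-sym a≢c) (≢-sym b≢c) a≢b))
    open Primal using (D; D≢0; X; Y; Z)

    -- The coefficients from `dual-conic-vanishes` and `Primal.conic`; the primes keep `F′` apart
    -- from the field `F`.
    F′ G′ H′ f g h : Carrier
    F′ = dot (proj₁ BC) A * Dual.s * Dual.u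
    G′ = dot (proj₁ CA) B * Dual.u * Dual.p′
    H′ = dot (proj₁ AB) C * Dual.r * Dual.p′
    f = Primal.p * Primal.s
    g = Primal.r * Primal.p′
    h = Primal.r * Primal.p

    F′≢0 : F′ ≢ 0#
    F′≢0 = *-≢0 (*-≢0 BC-A Dual.s≢0) Dual.u≢0
    G′≢0 : G′ ≢ 0#
    G′≢0 = *-≢0 (*-≢0 CA-B Dual.u≢0) Dual.p′≢0
    H′≢0 : H′ ≢ 0#
    H′≢0 = *-≢0 (*-≢0 AB-C Dual.r≢0) Dual.p′≢0
    f≢0 : f ≢ 0#
    f≢0 = *-≢0 Primal.p≢0 Primal.s≢0
    g≢0 : g ≢ 0#
    g≢0 = *-≢0 Primal.r≢0 Primal.p′≢0
    h≢0 : h ≢ 0#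
    h≢0 = *-≢0 Primal.r≢0 Primal.p≢0

    dual-form : Carrier → Carrier → Carrier → Carrier
    dual-form a b c = F′ * (b * c) + G′ * (a * c) + H′ * (a * b)

    dual-form-ab≡0 : ∀ {a b} c → a ≡ 0# → b ≡ 0# → dual-form a b c ≡ 0#
    dual-form-ab≡0 c refl refl = solve 4 (λ f g h c →
      f :* (con (+ 0) :* c) :+ g :* (con (+ 0) :* c) :+ h :* (con (+ 0) :* con (+ 0)) := con (+ 0)) refl F′ G′ H′ c

    dual-form-bc≡0 : ∀ a {b c} → b ≡ 0# → c ≡ 0# → dual-form a b c ≡ 0#
    dual-form-bc≡0 a refl refl = solve 4 (λ f g h a →
      f :* (con (+ 0) :* con (+ 0)) :+ g :* (a :* con (+ 0)) :+ h :* (a :* con (+ 0)) := con (+ 0)) refl F′ G′ H′ a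

    dual-form-ca≡0 : ∀ {a} b {c} → a ≡ 0# → c ≡ 0# → dual-form a b c ≡ 0#
    dual-form-ca≡0 b refl refl = solve 4 (λ f g h b →
      f :* (b :* con (+ 0)) :+ g :* (con (+ 0) :* con (+ 0)) :+ h :* (con (+ 0) :* b) := con (+ 0)) refl F′ G′ H′ b

    -- Segre's equation covers contact points other than those of the three sides. A tangent at one
    -- of these passes through two vertices of the triangle, and every monomial contains one of the
    -- two vanishing coordinates.
    dual-conic : ∀ L → Tangent Oₜ L → dual-form (dot (proj₁ L) A) (dot (proj₁ L) B) (dot (proj₁ L) C) ≡ 0#
    dual-conic L T = cases (proj₁ T ≟ᶠ i) (proj₁ T ≟ᶠ j) (proj₁ T ≟ᶠ k)
      where
      t = proj₁ L
      -- A tangent with the contact point of a side is that side.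
      same-zeros : ∀ {l m n s y} → l ≢ m → l ≢ n → m ≢ n → T.TangentAt l s → proj₁ T ≡ l → dot s y ≡ 0# → dot t y ≡ 0#
      same-zeros {m = m} {y = y} l≢m l≢n m≢n S refl sy≡0 = xy≡0⇒y≡0 (T.TangentAt.misses S (≢-sym l≢m))
        (trans (TS.tangent-unique l≢m l≢n m≢n (tangentAt L T) S y)
          (trans (cong (dot t (coordinates Oₜ m) *_) sy≡0) (zeroʳ _)))
      cases : Dec (proj₁ T ≡ i) → Dec (proj₁ T ≡ j) → Dec (proj₁ T ≡ k) → dual-form (dot t A) (dot t B) (dot t C) ≡ 0#
      cases (yes x≡i) _ _ = dual-form-bc≡0 _ (on-side BC-B) (on-side BC-C)
        where
        on-side : ∀ {y} → dot (proj₁ BC) y ≡ 0# → dot t y ≡ 0#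
        on-side = same-zeros i≢j i≢k j≢k (tangentAt BC tangent-BC) x≡i
      cases (no _) (yes x≡j) _ = dual-form-ca≡0 _ (on-side CA-A) (on-side CA-C)
        where
        on-side : ∀ {y} → dot (proj₁ CA) y ≡ 0# → dot t y ≡ 0#
        on-side = same-zeros j≢k (≢-sym i≢j) (≢-sym i≢k) (tangentAt CA tangent-CA) x≡j
      cases (no _) (no _) (yes x≡k) = dual-form-ab≡0 _ (on-side AB-A) (on-side AB-B)
        where
        on-side : ∀ {y} → dot (proj₁ AB) y ≡ 0# → dot t y ≡ 0#
        on-side = same-zeros (≢-sym i≢k) (≢-sym j≢k) i≢j (tangentAt AB tangent-AB) x≡k
      cases (no x≢i) (no x≢j) (no x≢k) =
        Dual.dual-conic-vanishes x≢i x≢j x≢k (tangentAt L T) BC-B BC-C CA-C CA-A AB-A AB-B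

    Corner : Fin (suc q) → Set
    Corner n = ∃ λ c → vertex c ≡ n

    corner? : ∀ n → Dec (Corner n)
    corner? n = any? (λ c → vertex c ≟ᶠ n)

    zero-product : ∀ {x y} → x * y ≡ 0# → x ≡ 0# ⊎ y ≡ 0#
    zero-product {x} xy≡0 with x ≟ 0#
    ... | yes x≡0 = inj₁ x≡0
    ... | no x≢0  = inj₂ (xy≡0⇒y≡0 x≢0 xy≡0)

    -- If a tangent passes through A, its equation reduces to F bc = 0, so it passes through B or C
    -- as well. It then contains two corners, and no further point of `Oₛ`.
    corner-neighbour : ∀ {m n} → m ≢ n → Side m n → Corner m → Corner n
    corner-neighbour {m} {n} m≢n (L , Lm , Ln , T) (c , refl) = neighbour c m≢n Lm
      where
      a′ b′ c′ : Carrier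
      a′ = dot (proj₁ L) A
      b′ = dot (proj₁ L) B
      c′ = dot (proj₁ L) C
      meets-corner : ∀ c d → vertex c ≢ vertex d → vertex c ≢ n → Through Oₛ L (vertex c) → Through Oₛ L (vertex d) → Corner n
      meets-corner c d c≢d c≢n Lc Ld with vertex d ≟ᶠ n
      ... | yes d≡n = d , d≡n
      ... | no d≢n  = contradiction Ln (third-off L (≢-sym c≢n) (≢-sym d≢n) c≢d Lc Ld)
      choose : ∀ c d e → vertex c ≢ vertex d → vertex c ≢ vertex e → vertex c ≢ n → Through Oₛ L (vertex c) →
               Through Oₛ L (vertex d) ⊎ Through Oₛ L (vertex e) → Corner n
      choose c d e c≢d c≢e c≢n Lc (inj₁ Ld) = meets-corner c d c≢d c≢n Lc Ld
      choose c d e c≢d c≢e c≢n Lc (inj₂ Le) = meets-corner c e c≢e c≢n Lc Le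
      drop-a : dual-form a′ b′ c′ ≡ 0# → a′ ≡ 0# → b′ * c′ ≡ 0#
      drop-a eq a≡0 = xy≡0⇒y≡0 F′≢0 (trans
        (solve 5 (λ f g h b c → f :* (b :* c) := f :* (b :* c) :+ g :* (con (+ 0) :* c) :+ h :* (con (+ 0) :* b)) refl F′ G′ H′ b′ c′)
        (subst (λ a → dual-form a b′ c′ ≡ 0#) a≡0 eq))
      drop-b : dual-form a′ b′ c′ ≡ 0# → b′ ≡ 0# → a′ * c′ ≡ 0#
      drop-b eq b≡0 = xy≡0⇒y≡0 G′≢0 (trans
        (solve 5 (λ f g h a c → g :* (a :* c) := f :* (con (+ 0) :* c) :+ g :* (a :* c) :+ h :* (a :* con (+ 0))) refl F′ G′ H′ a′ c′)
        (subst (λ b → dual-form a′ b c′ ≡ 0#) b≡0 eq))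
      drop-c : dual-form a′ b′ c′ ≡ 0# → c′ ≡ 0# → a′ * b′ ≡ 0#
      drop-c eq c≡0 = xy≡0⇒y≡0 H′≢0 (trans
        (solve 5 (λ f g h a b → h :* (a :* b) := f :* (b :* con (+ 0)) :+ g :* (a :* con (+ 0)) :+ h :* (a :* b)) refl F′ G′ H′ a′ b′)
        (subst (λ c → dual-form a′ b′ c ≡ 0#) c≡0 eq))
      neighbour : ∀ c → vertex c ≢ n → Through Oₛ L (vertex c) → Corner n
      neighbour 0F c≢n Lc = choose 0F 1F 2F a≢b a≢c c≢n Lc (zero-product (drop-a (dual-conic L T) Lc))
      neighbour 1F c≢n Lc = choose 1F 0F 2F (≢-sym a≢b) b≢c c≢n Lc (zero-product (drop-b (dual-conic L T) Lc))
      neighbour 2F c≢n Lc = choose 2F 0F 1F (≢-sym a≢c) (≢-sym b≢c) c≢n Lc (zero-product (drop-c (dual-conic L T) Lc))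

    x y z : Fin (suc q) → Carrier
    x n = X (coordinates Oₛ n)
    y n = Y (coordinates Oₛ n)
    z n = Z (coordinates Oₛ n)

    module Outside {n} (n-out : ¬ Corner n) where
      n≢a : n ≢ vertex 0F
      n≢a eq = n-out (0F , sym eq)
      n≢b : n ≢ vertex 1F
      n≢b eq = n-out (1F , sym eq)
      n≢c : n ≢ vertex 2F
      n≢c eq = n-out (2F , sym eq)

      x≢0 : x n ≢ 0#
      x≢0 = oval-arc Oₛ b≢c (≢-sym n≢b) (≢-sym n≢c)
      y≢0 : y n ≢ 0#
      y≢0 = oval-arc Oₛ (≢-sym a≢c) (≢-sym n≢c) (≢-sym n≢a)
      z≢0 : z n ≢ 0#
      z≢0 = oval-arc Oₛ a≢b (≢-sym n≢a) (≢-sym n≢b)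

      conic : f * (y n * z n) + g * (x n * z n) + h * (x n * y n) ≡ 0#
      conic = Primal.conic-vanishes n≢a n≢b n≢c
        (proj₂ (S.tangent-exists n (vertex 0F) (vertex 1F) n≢a n≢b a≢b))

    -- On a line with coefficients a, b, c the equation of the conic becomes a quadratic in x/y; the
    -- product of its two roots is b f / (a g).
    product-of-roots : ∀ {a b c m n} → ¬ Corner m → ¬ Corner n → m ≢ n →
      a * x m + b * y m + c * z m ≡ 0# → a * x n + b * y n + c * z n ≡ 0# →
      a * g * (x m * x n) ≡ b * f * (y m * y n) × a * h * (x m * x n) ≡ c * f * (z m * z n)
    product-of-roots {a} {b} {c} {m} {n} m-out n-out m≢n lm ln =
        x-y≡0⇒x≡y (xy≡0⇒y≡0 xy≢0 (quadratic (x m) (y m) (z m) (x n) (y n) (z n) g h b c (lm , ln , conic m-out , conic n-out)))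
      , x-y≡0⇒x≡y (xy≡0⇒y≡0 xz≢0 (quadratic (x m) (z m) (y m) (x n) (z n) (y n) h g c b
          (trans (swap-linear _ _ _) lm , trans (swap-linear _ _ _) ln ,
           trans (swap-conic _ _ _) (conic m-out) , trans (swap-conic _ _ _) (conic n-out))))
      where
      open Outside
      swap-linear : ∀ s t r → s + t + r ≡ s + r + t
      swap-linear = solve 3 (λ s t r → s :+ t :+ r := s :+ r :+ t) refl
      swap-conic : ∀ s t r → f * (r * t) + h * (s * t) + g * (s * r) ≡ f * (t * r) + g * (s * r) + h * (s * t)
      swap-conic s t r = solve 6 (λ f g h s t r →
        f :* (r :* t) :+ h :* (s :* t) :+ g :* (s :* r) := f :* (t :* r) :+ g :* (s :* r) :+ h :* (s :* t)) refl f g h s t r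
      -- Eliminating z leaves ag x² + (af + bg - ch) xy + bf y² = 0 at both points. Weighting the
      -- two equations by x′y′ and xy and subtracting removes the middle term.
      quadratic : ∀ x y z x′ y′ z′ g h b c →
        (a * x + b * y + c * z ≡ 0# × a * x′ + b * y′ + c * z′ ≡ 0# ×
         f * (y * z) + g * (x * z) + h * (x * y) ≡ 0# × f * (y′ * z′) + g * (x′ * z′) + h * (x′ * y′) ≡ 0#) →
        (x * y′ - y * x′) * (a * g * (x * x′) - b * f * (y * y′)) ≡ 0#
      quadratic x y z x′ y′ z′ g h b c (l , l′ , s , s′) = begin
        (x * y′ - y * x′) * (a * g * (x * x′) - b * f * (y * y′))
          ≡⟨ solve 12 (λ a b c f g h x y z x′ y′ z′ →
               (x :* y′ :- y :* x′) :* (a :* g :* (x :* x′) :- b :* f :* (y :* y′)) :=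
               x′ :* y′ :* ((a :* x :+ b :* y :+ c :* z) :* (f :* y :+ g :* x) :- c :* (f :* (y :* z) :+ g :* (x :* z) :+ h :* (x :* y)))
               :- x :* y :* ((a :* x′ :+ b :* y′ :+ c :* z′) :* (f :* y′ :+ g :* x′) :- c :* (f :* (y′ :* z′) :+ g :* (x′ :* z′) :+ h :* (x′ :* y′))))
               refl a b c f g h x y z x′ y′ z′ ⟩
        x′ * y′ * ((a * x + b * y + c * z) * (f * y + g * x) - c * (f * (y * z) + g * (x * z) + h * (x * y)))
          - x * y * ((a * x′ + b * y′ + c * z′) * (f * y′ + g * x′) - c * (f * (y′ * z′) + g * (x′ * z′) + h * (x′ * y′)))
          ≡⟨ cong₂ (λ u v → x′ * y′ * u - x * y * v) (vanish (f * y + g * x) l s) (vanish (f * y′ + g * x′) l′ s′) ⟩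
        x′ * y′ * 0# - x * y * 0#
          ≡⟨ solve 2 (λ u v → u :* con (+ 0) :- v :* con (+ 0) := con (+ 0)) refl (x′ * y′) (x * y) ⟩
        0# ∎
        where
        vanish : ∀ {l s} w → l ≡ 0# → s ≡ 0# → l * w - c * s ≡ 0#
        vanish w refl refl = solve 2 (λ w c → con (+ 0) :* w :- c :* con (+ 0) := con (+ 0)) refl w c
      M N : Vec3
      M = coordinates Oₛ m
      N = coordinates Oₛ n
      -- The roots x/y are different because the two points lie on different lines through C.
      xy≢0 : x m * y n - y m * x n ≢ 0#
      xy≢0 eq = *-≢0 (oval-arc Oₛ (≢-sym a≢c) (≢-sym b≢c) a≢b)
        (oval-arc Oₛ (≢-sym (n≢c m-out)) (≢-sym (n≢c n-out)) m≢n)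
        (trans (plücker C A B M N) eq)
      xz≢0 : x m * z n - z m * x n ≢ 0#
      xz≢0 eq = *-≢0 (oval-arc Oₛ b≢c (≢-sym a≢b) (≢-sym a≢c))
        (oval-arc Oₛ (≢-sym (n≢b m-out)) (≢-sym (n≢b n-out)) m≢n)
        (trans (plücker B C A M N) (trans (solve 4 (λ s t u v → s :* t :- u :* v := :- (u :* v :- s :* t)) refl (z m) (x n) (x m) (z n))
          (trans (cong -_ eq) (solve 0 (:- con (+ 0) := con (+ 0)) refl))))

    -- F/f, G/g and H/h, multiplied by fgh to avoid division.
    κ₁ κ₂ κ₃ : Carrier
    κ₁ = F′ * g * h
    κ₂ = G′ * f * h
    κ₃ = H′ * f * g

    κ₁≢0 : κ₁ ≢ 0#
    κ₁≢0 = *-≢0 (*-≢0 F′≢0 g≢0) h≢0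

    -- The coordinates of `n` stand next to the coefficients, so that this is literally an equation
    -- in `m` of the polar of `n`, as `product-of-roots` expects.
    Conjugate : Fin (suc q) → Fin (suc q) → Set
    Conjugate m n = κ₁ * x n * x m + κ₂ * y n * y m + κ₃ * z n * z m ≡ 0#

    conjugate-sym : ∀ {m n} → Conjugate m n → Conjugate n m
    conjugate-sym {m} {n} eq = trans
      (solve 9 (λ a b c x y z x′ y′ z′ →
        a :* x :* x′ :+ b :* y :* y′ :+ c :* z :* z′ := a :* x′ :* x :+ b :* y′ :* y :+ c :* z′ :* z)
        refl κ₁ κ₂ κ₃ (x m) (y m) (z m) (x n) (y n) (z n)) eq

    on-line : ∀ (L : Line) {n} → Through Oₛ L n →
              dot (proj₁ L) A * x n + dot (proj₁ L) B * y n + dot (proj₁ L) C * z n ≡ 0#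
    on-line L {n} Ln = trans (sym (cramer A B C (proj₁ L) (coordinates Oₛ n))) (trans (cong (D *_) Ln) (zeroʳ D))

    -- The proportion of `product-of-roots` turns the conjugacy sum into a multiple of `dual-form`
    -- at the coefficients of the line. The factor `b * c` clears denominators; it is nonzero since
    -- the line already contains two points of `Oₛ` that are not corners.
    side⇒conjugate : ∀ {m n} → ¬ Corner m → ¬ Corner n → m ≢ n → Side m n → Conjugate m n
    side⇒conjugate {m} {n} m-out n-out m≢n (L , Lm , Ln , T) = xy≡0⇒y≡0 (*-≢0 b≢0 c≢0) (begin
      b * c * (κ₁ * x n * x m + κ₂ * y n * y m + κ₃ * z n * z m)
        ≡⟨ expand b c f g h F′ G′ H′ (x m) (y m) (z m) (x n) (y n) (z n) ⟩
      F′ * g * h * b * c * (x m * x n) + G′ * h * c * (b * f * (y m * y n)) + H′ * g * b * (c * f * (z m * z n))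
        ≡⟨ cong₂ (λ u v → F′ * g * h * b * c * (x m * x n) + G′ * h * c * u + H′ * g * b * v) (proj₁ roots) (proj₂ roots) ⟨
      F′ * g * h * b * c * (x m * x n) + G′ * h * c * (a * g * (x m * x n)) + H′ * g * b * (a * h * (x m * x n))
        ≡⟨ solve 9 (λ a b c g h F G H X →
             F :* g :* h :* b :* c :* X :+ G :* h :* c :* (a :* g :* X) :+ H :* g :* b :* (a :* h :* X) :=
             g :* h :* X :* (F :* (b :* c) :+ G :* (a :* c) :+ H :* (a :* b)))
             refl a b c g h F′ G′ H′ (x m * x n) ⟩
      g * h * (x m * x n) * dual-form a b c
        ≡⟨ cong (g * h * (x m * x n) *_) (dual-conic L T) ⟩
      g * h * (x m * x n) * 0#
        ≡⟨ zeroʳ _ ⟩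
      0# ∎)
      where
      open Outside
      a b c : Carrier
      a = dot (proj₁ L) A
      b = dot (proj₁ L) B
      c = dot (proj₁ L) C
      b≢0 : b ≢ 0#
      b≢0 = third-off L (≢-sym (n≢b m-out)) (≢-sym (n≢b n-out)) m≢n Lm Ln
      c≢0 : c ≢ 0#
      c≢0 = third-off L (≢-sym (n≢c m-out)) (≢-sym (n≢c n-out)) m≢n Lm Ln
      roots = product-of-roots m-out n-out m≢n (on-line L Lm) (on-line L Ln)
      expand : ∀ b c f g h F G H x y z x′ y′ z′ →
        b * c * (F * g * h * x′ * x + G * f * h * y′ * y + H * f * g * z′ * z) ≡
        F * g * h * b * c * (x * x′) + G * h * c * (b * f * (y * y′)) + H * g * b * (c * f * (z * z′))
      expand = solve 14 (λ b c f g h F G H x y z x′ y′ z′ →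
        b :* c :* (F :* g :* h :* x′ :* x :+ G :* f :* h :* y′ :* y :+ H :* f :* g :* z′ :* z) :=
        F :* g :* h :* b :* c :* (x :* x′) :+ G :* h :* c :* (b :* f :* (y :* y′)) :+ H :* g :* b :* (c :* f :* (z :* z′))) refl

    -- The polar of n meets the conic in m and o.
    conjugate-trans : ∀ {m n o} → ¬ Corner m → ¬ Corner n → ¬ Corner o → m ≢ o →
                      Conjugate m n → Conjugate o n → Conjugate m o
    conjugate-trans {m} {n} {o} m-out n-out o-out m≢o mn on =
      xy≡0⇒y≡0 (*-≢0 (*-≢0 f≢0 (y≢0 n-out)) (z≢0 n-out)) (begin
        f * y n * z n * (κ₁ * x o * x m + κ₂ * y o * y m + κ₃ * z o * z m)
          ≡⟨ solve 12 (λ f y z a b c x₁ y₁ z₁ x₂ y₂ z₂ →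
               f :* y :* z :* (a :* x₂ :* x₁ :+ b :* y₂ :* y₁ :+ c :* z₂ :* z₁) :=
               f :* y :* z :* a :* (x₁ :* x₂) :+ z :* (b :* y :* f :* (y₁ :* y₂)) :+ y :* (c :* z :* f :* (z₁ :* z₂)))
               refl f (y n) (z n) κ₁ κ₂ κ₃ (x m) (y m) (z m) (x o) (y o) (z o) ⟩
        f * y n * z n * κ₁ * (x m * x o) + z n * (κ₂ * y n * f * (y m * y o)) + y n * (κ₃ * z n * f * (z m * z o))
          ≡⟨ cong₂ (λ u v → f * y n * z n * κ₁ * (x m * x o) + z n * u + y n * v) (proj₁ roots) (proj₂ roots) ⟨
        f * y n * z n * κ₁ * (x m * x o) + z n * (κ₁ * x n * g * (x m * x o)) + y n * (κ₁ * x n * h * (x m * x o))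
          ≡⟨ solve 8 (λ f g h x y z a X →
               f :* y :* z :* a :* X :+ z :* (a :* x :* g :* X) :+ y :* (a :* x :* h :* X) :=
               a :* X :* (f :* (y :* z) :+ g :* (x :* z) :+ h :* (x :* y)))
               refl f g h (x n) (y n) (z n) κ₁ (x m * x o) ⟩
        κ₁ * (x m * x o) * (f * (y n * z n) + g * (x n * z n) + h * (x n * y n))
          ≡⟨ cong (κ₁ * (x m * x o) *_) (conic n-out) ⟩
        κ₁ * (x m * x o) * 0#
          ≡⟨ zeroʳ _ ⟩
        0# ∎)
      where
      open Outside
      -- The line is now the polar of `n`, with coefficients such as `κ₁ * x n`. The conjugacy sum
      -- for `m` and `o` becomes proportional to f/x + g/y + h/z at `n`, which is the conic's
      -- equation divided by xyz.
      roots = product-of-roots m-out o-out m≢o mn on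

    polar : ∀ n → ¬ Corner n → Σ Line λ L → ∀ {m} → Conjugate m n → Through Oₛ L m
    polar n n-out = (l , l≢0) , λ {m} mn → trans (l-value (coordinates Oₛ m)) mn
      where
      l = linear-combination 1# (linear-combination (κ₁ * x n) (cross B C) (κ₂ * y n) (cross C A)) (κ₃ * z n) (cross A B)
      l-value : ∀ v → dot l v ≡ κ₁ * x n * X v + κ₂ * y n * Y v + κ₃ * z n * Z v
      l-value v = trans
        (dot-linear-combination 1# (linear-combination (κ₁ * x n) (cross B C) (κ₂ * y n) (cross C A)) (κ₃ * z n) (cross A B) v)
        (cong (_+ κ₃ * z n * Z v) (trans (*-identityˡ _)
          (dot-linear-combination (κ₁ * x n) (cross B C) (κ₂ * y n) (cross C A) v)))
      l≢0 : ¬ IsZero l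
      l≢0 (l₀ , l₁ , l₂) = *-≢0 (*-≢0 κ₁≢0 (Outside.x≢0 n-out)) (oval-arc Oₛ b≢c (≢-sym a≢b) (≢-sym a≢c)) (begin
        κ₁ * x n * X A
          ≡⟨ solve 3 (λ s t u → s := s :+ t :* con (+ 0) :+ u :* con (+ 0)) refl (κ₁ * x n * X A) (κ₂ * y n) (κ₃ * z n) ⟩
        κ₁ * x n * X A + κ₂ * y n * 0# + κ₃ * z n * 0#
          ≡⟨ cong₂ (λ s t → κ₁ * x n * X A + κ₂ * y n * s + κ₃ * z n * t) (det-abb C A) (det-aba A B) ⟨
        κ₁ * x n * X A + κ₂ * y n * Y A + κ₃ * z n * Z A
          ≡⟨ l-value A ⟨
        dot l A
          ≡⟨ zero-dot l₀ l₁ l₂ A ⟩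
        0# ∎)
        where
        zero-dot : ∀ {l₀ l₁ l₂} → l₀ ≡ 0# → l₁ ≡ 0# → l₂ ≡ 0# → ∀ v → dot ⟨ l₀ , l₁ , l₂ ⟩ v ≡ 0#
        zero-dot refl refl refl v = solve 3 (λ a b c → con (+ 0) :* a :+ con (+ 0) :* b :+ con (+ 0) :* c := con (+ 0))
          refl (c₀ v) (c₁ v) (c₂ v)

    -- By `corner-neighbour`, being a corner propagates along the path in both directions: either
    -- all four points are corners, too many for a triangle, or none is and conjugacy applies
    -- throughout.
    no-path : (w : Fin 4 → Fin (suc q)) → (∀ {i j} → w i ≡ w j → i ≡ j) →
              Side (w 0F) (w 1F) → Side (w 1F) (w 2F) → Side (w 2F) (w 3F) → ⊥
    no-path w w-injective s₀₁ s₁₂ s₂₃ with corner? (w 0F)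
    ... | yes in₀ = <⇒notInjective {f = λ i → proj₁ (corner i)} (ℕₚ.n<1+n 3)
            (λ {i} {j} eq → w-injective (trans (sym (proj₂ (corner i))) (trans (cong vertex eq) (proj₂ (corner j)))))
      where
      in₁ = corner-neighbour (λ eq → contradiction (w-injective eq) λ ()) s₀₁ in₀
      in₂ = corner-neighbour (λ eq → contradiction (w-injective eq) λ ()) s₁₂ in₁
      in₃ = corner-neighbour (λ eq → contradiction (w-injective eq) λ ()) s₂₃ in₂
      corner : ∀ i → Corner (w i)
      corner 0F = in₀
      corner 1F = in₁
      corner 2F = in₂
      corner 3F = in₃
    ... | no out₀ = noThree Oₛ _ _ _ (w≢ λ ()) (w≢ λ ()) (w≢ λ ())
            (proj₁ (polar (w 2F) out₂) ,
             proj₂ (polar (w 2F) out₂) conj₀₂ ,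
             proj₂ (polar (w 2F) out₂) conj₁₂ ,
             proj₂ (polar (w 2F) out₂) (conjugate-sym conj₂₃))
      where
      w≢ : ∀ {i j} → i ≢ j → w i ≢ w j
      w≢ i≢j eq = i≢j (w-injective eq)
      out₁ : ¬ Corner (w 1F)
      out₁ in₁ = out₀ (corner-neighbour (w≢ λ ()) (side-sym s₀₁) in₁)
      out₂ : ¬ Corner (w 2F)
      out₂ in₂ = out₁ (corner-neighbour (w≢ λ ()) (side-sym s₁₂) in₂)
      out₃ : ¬ Corner (w 3F)
      out₃ in₃ = out₂ (corner-neighbour (w≢ λ ()) (side-sym s₂₃) in₃)
      conj₀₁ : Conjugate (w 0F) (w 1F)
      conj₀₁ = side⇒conjugate out₀ out₁ (w≢ λ ()) s₀₁
      conj₁₂ : Conjugate (w 1F) (w 2F)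
      conj₁₂ = side⇒conjugate out₁ out₂ (w≢ λ ()) s₁₂
      conj₂₃ : Conjugate (w 2F) (w 3F)
      conj₂₃ = side⇒conjugate out₂ out₃ (w≢ λ ()) s₂₃
      conj₀₂ : Conjugate (w 0F) (w 2F)
      conj₀₂ = conjugate-trans out₀ out₁ out₂ (w≢ λ ()) conj₀₁ (conjugate-sym conj₁₂)

open import Data.Nat using (_+_)

theorem4 : (q : ℕ) → OddPrimePower q → (F : FiniteField q) →
    (Oₜ Oₛ : PG2.Oval F) → PG2.PonceletPolygon F Oₜ Oₛ 3 →
    (m : ℕ) → 4 ≤ m → m ≤ q + 1 → ¬ PG2.PonceletPolygon F Oₜ Oₛ m
theorem4 q q-odd F Oₜ Oₛ triangle (suc (suc (suc (suc m)))) (s≤s (s≤s (s≤s (s≤s _)))) _ polygon =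
  -- With four successors exposed, `cyc` computes on the first three indices, so the first three
  -- sides join consecutive points of the path.
  no-path (λ i → vertex (i ↑ˡ m)) (λ eq → ↑ˡ-injective m _ _ (injective eq)) (sides 0F) (sides 1F) (sides 2F)
  where
  open PG2.PonceletPolygon polygon
  open Ovals.PonceletTriangle F (oddPrimePower⇒odd q-odd) Oₜ Oₛ triangle using (no-path)
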